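{- $$F_{123}(x,y)=F_{321}(x,y)=\frac{1+xy-x-\sqrt{1-2x-3x^2-xy(2-2x-xy)}}{2x(x+y-xy)}.$$
   Context: The patterns $123$ and $321$ are written without dashes, so an occurrence of $123$ (resp. $321$) in $\pi=\pi_1\cdots\pi_n\in S_n$ is a position $i$ with $\pi_i<\pi_{i+1}<\pi_{i+2}$ (resp. $\pi_i>\pi_{i+1}>\pi_{i+2}$). A permutation is $1\text{ - }3\text{ - }2$-avoiding if there are no positions $a<b<c$ with $\pi_a<\pi_c<\pi_b$. $f_{\tau;r}(n)$ is the number of $1\text{ - }3\text{ - }2$-avoiding permutations in $S_n$ containing exactly $r$ occurrences of $\tau$ (with $S_0$ consisting of the empty permutation), and $F_\tau(x,y)=\sum_{n,r\ge 0} f_{\tau;r}(n)x^ny^r$, a formal power series in $x$ with coefficients in $\mathbb Z[y]$. The square root denotes the formal power series in $x$ with constant term $1$. -}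

module Defs where

open import Level using (Level; 0ℓ)
open import Algebra.Bundles.Raw using (RawRing)
import Algebra.Definitions.RawMonoid as RawMonoidDefs
import Algebra.Definitions.RawSemiring as RawSemiringDefs
open import Data.Fin.Base as Fin using (Fin; toℕ)
import Data.Fin.Properties as Fin
open import Data.Integer.Base as ℤ using (ℤ; +_; 0ℤ; 1ℤ; +-*-rawRing)
import Data.Integer.Properties as ℤ
open import Data.List.Base as List using (List; []; _∷_; [_]; length; filter; allFin; cartesianProductWith)
import Data.List.Properties as List
import Data.List.Relation.Unary.All as ListAll
open import Data.Nat.Base as ℕ using (ℕ; zero; suc; _∸_; _≤_; _<_; z≤n; s≤s; _⊔_)
import Data.Nat.Properties as ℕ
open import Data.Product.Base using (_×_; _,_)
open import Data.Sum.Base using (inj₁; inj₂)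
open import Data.Vec.Base as Vec using (Vec; []; _∷_; lookup)
open import Data.Vec.Relation.Unary.AllPairs using (allPairs?)
open import Data.Vec.Relation.Unary.Unique.Propositional using (Unique)
open import Relation.Binary.PropositionalEquality using (_≡_; refl; sym; trans; cong; cong₂)
open import Relation.Nullary using (Dec; ¬_)
open import Relation.Nullary.Decidable using (_×-dec_; _→-dec_; ¬?)
open import Relation.Unary using (Decidable)

private
  variable
    c ℓ : Level
    A : Set
    m n : ℕ

-- A permutation of Fin n (letters numbered from 0) in one-line notation is a
-- word of length n with distinct letters; `words n n` lists every word of
-- length n over Fin n exactly once.

words : (n m : ℕ) → List (Vec (Fin n) m)
words n zero    = [ [] ]
words n (suc m) = cartesianProductWith _∷_ (allFin n) (words n m)

Avoids132 : Vec (Fin n) m → Set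
Avoids132 {m = m} π = (i j k : Fin m) → i Fin.< j → j Fin.< k →
  ¬ (lookup π i Fin.< lookup π k × lookup π k Fin.< lookup π j)

data Pattern : Set where
  p123 p321 : Pattern

consecutiveTriples : Vec A n → List (A × A × A)
consecutiveTriples (a ∷ b ∷ c ∷ w) = (a , b , c) ∷ consecutiveTriples (b ∷ c ∷ w)
consecutiveTriples _               = []

Matches : Pattern → Fin n × Fin n × Fin n → Set
Matches p123 (a , b , c) = a Fin.< b × b Fin.< c
Matches p321 (a , b , c) = b Fin.< a × c Fin.< b

matches? : (τ : Pattern) → Decidable (Matches {n} τ)
matches? p123 (a , b , c) = (a Fin.<? b) ×-dec (b Fin.<? c)
matches? p321 (a , b , c) = (b Fin.<? a) ×-dec (c Fin.<? b)

occurrences : Pattern → Vec (Fin n) m → ℕ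
occurrences τ π = length (filter (matches? τ) (consecutiveTriples π))

Counted : Pattern → (r : ℕ) → Vec (Fin n) n → Set
Counted τ r π = Unique π × Avoids132 π × occurrences τ π ≡ r

avoids132? : Decidable (Avoids132 {n} {m})
avoids132? π = Fin.all? λ i → Fin.all? λ j → Fin.all? λ k →
  (i Fin.<? j) →-dec ((j Fin.<? k) →-dec
    ¬? ((lookup π i Fin.<? lookup π k) ×-dec (lookup π k Fin.<? lookup π j)))

counted? : (τ : Pattern) (r : ℕ) → Decidable (Counted {n} τ r)
counted? τ r π =
  allPairs? (λ a b → ¬? (a Fin.≟ b)) π ×-dec
  avoids132? π ×-dec
  (occurrences τ π ℕ.≟ r)

f : Pattern → (r n : ℕ) → ℕ
f τ r n = length (filter (counted? τ r) (words n n))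

powerSeries : RawRing c ℓ → RawRing c ℓ
powerSeries R = record
  { Carrier = ℕ → R.Carrier
  ; _≈_     = λ a b → ∀ n → a n R.≈ b n
  ; _+_     = λ a b n → a n R.+ b n
  ; _*_     = λ a b n → sum {suc n} λ i → a (toℕ i) R.* b (n ∸ toℕ i)
  ; -_      = λ a n → R.- a n
  ; 0#      = λ _ → R.0#
  ; 1#      = λ { zero → R.1# ; (suc _) → R.0# }
  }
  where
  module R = RawRing R
  open RawMonoidDefs R.+-rawMonoid using (sum)

private
  module ℤ⟦y⟧ = RawRing (powerSeries +-*-rawRing)

-- `size` is only an upper bound on the support, and is ignored by equality.

record Polynomial : Set where
  field
    coeff    : ℕ → ℤ
    size     : ℕ
    vanishes : ∀ r → size ≤ r → coeff r ≡ 0ℤ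

open Polynomial

private
  sum-zero : ∀ n (t : Fin n → ℤ) → (∀ i → t i ≡ 0ℤ) →
             RawMonoidDefs.sum ℤ.+-0-rawMonoid t ≡ 0ℤ
  sum-zero zero    t t≡0 = refl
  sum-zero (suc n) t t≡0 =
    cong₂ ℤ._+_ (t≡0 Fin.zero) (sum-zero n (λ i → t (Fin.suc i)) (λ i → t≡0 (Fin.suc i)))

  *-vanishes : (p q : Polynomial) → ∀ r → size p ℕ.+ size q ≤ r →
               (coeff p ℤ⟦y⟧.* coeff q) r ≡ 0ℤ
  *-vanishes p q r le = sum-zero (suc r) _ term
    where
    term : ∀ (i : Fin (suc r)) → coeff p (toℕ i) ℤ.* coeff q (r ∸ toℕ i) ≡ 0ℤ
    term i with ℕ.≤-total (size p) (toℕ i)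
    ... | inj₁ p≤i = cong (ℤ._* coeff q (r ∸ toℕ i)) (vanishes p (toℕ i) p≤i)
    ... | inj₂ i≤p = trans
      (cong (coeff p (toℕ i) ℤ.*_) (vanishes q (r ∸ toℕ i) q≤r∸i))
      (ℤ.*-zeroʳ (coeff p (toℕ i)))
      where
      q≤r∸i : size q ≤ r ∸ toℕ i
      q≤r∸i = ℕ.m+n≤o⇒m≤o∸n (size q)
        (ℕ.≤-trans (ℕ.+-monoʳ-≤ (size q) i≤p)
          (ℕ.≤-trans (ℕ.≤-reflexive (ℕ.+-comm (size q) (size p))) le))

ℤ[y] : RawRing 0ℓ 0ℓ
ℤ[y] = record
  { Carrier = Polynomial
  ; _≈_     = λ p q → coeff p ℤ⟦y⟧.≈ coeff q
  ; _+_     = λ p q → record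
    { coeff    = coeff p ℤ⟦y⟧.+ coeff q
    ; size     = size p ⊔ size q
    ; vanishes = λ r le → cong₂ ℤ._+_
        (vanishes p r (ℕ.m⊔n≤o⇒m≤o (size p) (size q) le))
        (vanishes q r (ℕ.m⊔n≤o⇒n≤o (size p) (size q) le))
    }
  ; _*_     = λ p q → record
    { coeff    = coeff p ℤ⟦y⟧.* coeff q
    ; size     = size p ℕ.+ size q
    ; vanishes = *-vanishes p q
    }
  ; -_      = λ p → record
    { coeff    = ℤ⟦y⟧.- coeff p
    ; size     = size p
    ; vanishes = λ r le → cong ℤ.-_ (vanishes p r le)
    }
  ; 0#      = record { coeff = ℤ⟦y⟧.0# ; size = 0 ; vanishes = λ _ _ → refl }
  ; 1#      = record { coeff = ℤ⟦y⟧.1# ; size = 1 ; vanishes = λ { (suc _) _ → refl } }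
  }

y : Polynomial
y = record
  { coeff    = λ { 1 → 1ℤ ; _ → 0ℤ }
  ; size     = 2
  ; vanishes = λ { (suc (suc _)) _ → refl ; (suc zero) (s≤s ()) }
  }

ℤ[y]⟦x⟧ : RawRing 0ℓ 0ℓ
ℤ[y]⟦x⟧ = powerSeries ℤ[y]

private
  length-triples : (π : Vec A n) → length (consecutiveTriples π) ≤ n
  length-triples []              = z≤n
  length-triples (_ ∷ [])        = z≤n
  length-triples (_ ∷ _ ∷ [])    = z≤n
  length-triples (_ ∷ b ∷ c ∷ w) = s≤s (length-triples (b ∷ c ∷ w))

  occurrences≤n : (τ : Pattern) (π : Vec (Fin m) n) → occurrences τ π ≤ n
  occurrences≤n τ π = ℕ.≤-trans
    (List.length-filter (matches? τ) (consecutiveTriples π)) (length-triples π)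

  f-vanishes : ∀ τ n r → n < r → f τ r n ≡ 0
  f-vanishes τ n r n<r = cong length
    (List.filter-none (counted? τ r) (ListAll.universal none (words n n)))
    where
    none : (π : Vec (Fin n) n) → ¬ Counted τ r π
    none π (_ , _ , eq) =
      ℕ.<⇒≱ n<r (ℕ.≤-trans (ℕ.≤-reflexive (sym eq)) (occurrences≤n τ π))

F : Pattern → RawRing.Carrier ℤ[y]⟦x⟧
F τ n = record
  { coeff    = λ r → + f τ r n
  ; size     = suc n
  ; vanishes = λ r n<r → cong +_ (f-vanishes τ n r n<r)
  }

open RawRing ℤ[y]⟦x⟧ public
  using (_≈_; _≉_; _+_; _*_; -_; 0#; 1#)
  renaming (Carrier to Series)

-- n · a is the n-fold sum a + … + a.

open RawSemiringDefs (RawRing.rawSemiring ℤ[y]⟦x⟧) public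
  using (_^_) renaming (_×_ to _·_)

infixl 6 _-_
_-_ : Series → Series → Series
a - b = a + - b

X Y : Series
X 1 = RawRing.1# ℤ[y]
X _ = RawRing.0# ℤ[y]
Y zero    = y
Y (suc _) = RawRing.0# ℤ[y]

-- ℤ[y]⟦x⟧ is an integral domain of characteristic 0, so a has at most one
-- square root with constant term 1, up to _≈_.

infix 4 _IsSqrtOf_
_IsSqrtOf_ : Series → Series → Set
S IsSqrtOf a = RawRing._≈_ ℤ[y] (S 0) (RawRing.1# ℤ[y]) × S ^ 2 ≈ a

-- Q = N / D in the field of fractions of ℤ[y]⟦x⟧; D need not be a unit.

infix 4 _IsQuotient_/_
_IsQuotient_/_ : Series → Series → Series → Set
Q IsQuotient N / D = D ≉ 0# × D * Q ≈ N

-- Splitting a non-empty 1-3-2-avoiding permutation at its largest letter m gives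
-- u m v with u, v 1-3-2-avoiding and every letter of u above every letter of v.
-- No occurrence of 321 or 123 has m in the middle, so occurrences of 321 are those
-- of u and those of m v, and occurrences of 123 are those of u m and those of v.
-- Let P be the analogue of F in which the occurrences are counted after putting a
-- larger letter in front of (for 321) or behind (for 123) the permutation.
-- Both patterns then give F = 1 + x F P and P = 1 + x (P² + (y - 1)(P - 1)), and
-- eliminating P yields b F = 1 + a F² with b = 1 + xy - x and a = x (x + y - xy).
-- A difference of two solutions is a multiple of x times itself, hence zero, and
-- b - 2aF is the required square root, as (b - 2aF)² = b² - 4a.
module Submission where

open import Algebra.Bundles using (CommutativeRing)
open import Algebra.Bundles.Raw using (RawRing)
import Algebra.Definitions.RawSemiring as RawSemiringDefinitions
import Algebra.Morphism.RingMonomorphism as RingMonomorphism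
open import Algebra.Morphism.Structures using (IsRingMonomorphism)
import Algebra.Properties.AbelianGroup as AbelianGroupProperties
import Algebra.Properties.CommutativeMonoid.Sum as Sum
import Algebra.Properties.CommutativeSemigroup as CommutativeSemigroupProperties
import Algebra.Properties.Ring as RingProperties
import Algebra.Properties.Semiring.Exp as Exp
import Algebra.Properties.Semiring.Mult.TCOptimised as SemiringMult
import Algebra.Solver.Ring as RingSolver
open import Algebra.Solver.Ring.AlmostCommutativeRing using (_-Raw-AlmostCommutative⟶_; fromCommutativeRing)
open import Data.Bool.Base using (Bool; true; false; _∧_)
import Data.Bool.Properties as Bool
open import Data.Fin.Base as Fin using (Fin; toℕ; fromℕ<)
import Data.Fin.Properties as Fin
open import Data.Integer.Base as ℤ using (ℤ; -[1+_]; _⊖_; _◃_)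
import Data.Integer.Properties as ℤ
open import Data.List.Base using (List; []; _∷_; _++_; [_]; length; map; filter; concat; tabulate; cartesianProduct)
open import Data.List.Membership.Propositional using (_∈_; _∉_)
open import Data.List.Membership.Propositional.Properties
open import Data.List.Membership.Propositional.Properties.WithK using (unique∧set⇒bag)
import Data.List.Properties as List
open import Data.List.Relation.Binary.BagAndSetEquality using (∼bag⇒↭)
open import Data.List.Relation.Binary.Permutation.Propositional
  using (_↭_; ↭⇒↭ₛ; ↭-sym; ↭-trans; ↭-prep; ↭-refl; ↭-reflexive; module PermutationReasoning)
import Data.List.Relation.Binary.Permutation.Propositional.Properties as Perm
open Perm using (∈-resp-↭; ↭-length; shift; drop-mid; ++⁺; ++-comm)
import Data.List.Relation.Binary.Permutation.Setoid.Properties as SetoidPerm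
open import Data.List.Relation.Binary.Sublist.Propositional as Sublist using (_⊆_; _∷_; _∷ʳ_; []; ⊆-trans; ⊆-refl; minimum)
import Data.List.Relation.Binary.Sublist.Propositional.Properties as Sublist
open import Data.List.Relation.Unary.All as All using (All; []; _∷_)
import Data.List.Relation.Unary.All.Properties as All
open import Data.List.Relation.Unary.AllPairs using ([]; _∷_)
import Data.List.Relation.Unary.AllPairs.Properties as AllPairs
open import Data.List.Relation.Unary.Any using (here; there)
open import Data.List.Relation.Unary.Unique.Propositional using (Unique)
import Data.List.Relation.Unary.Unique.Propositional.Properties as Unique
import Data.Maybe.Base as Maybe
open import Data.Nat.Base as ℕ using (ℕ; zero; suc; _∸_; _≤_; _<_; z≤n; s≤s; _<ᵇ_)
import Data.Nat.Properties as ℕ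
open import Data.Product using (_×_; _,_; proj₁; proj₂; ∃; ∃₂; ∃-syntax; uncurry)
import Data.Sign.Base as Sign
open import Data.Sum.Base using (inj₁; inj₂)
open import Data.Vec.Base using (Vec; []; _∷_; lookup)
import Data.Vec.Properties as Vec
open import Data.Vec.Relation.Unary.All as VecAll using ([]; _∷_)
open import Data.Vec.Relation.Unary.AllPairs using ([]; _∷_; allPairs?)
import Data.Vec.Relation.Unary.Unique.Propositional as Vec using (Unique)
open import Function.Base using (_∘_; id)
open import Function.Bundles using (mk⇔)
open import Level using (Level; 0ℓ)
open import Relation.Binary.PropositionalEquality as ≡ using (_≡_; _≢_)
import Relation.Binary.Reasoning.Setoid as SetoidReasoning
open import Relation.Nullary using (¬_; contradiction; does; yes; no)
open import Relation.Nullary.Decidable using (dec⇒maybe; ¬?; _×-dec_)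
open import Relation.Unary using (Decidable)
import Defs
open Defs using (powerSeries; ℤ[y]; Polynomial; Pattern; p123; p321; words; Avoids132; avoids132?
                ; occurrences; counted?; f; consecutiveTriples; matches?)

-- The linear coefficient b has constant term 1 in x, so the quadratic equation determines every
-- coefficient of F from lower ones, although its leading coefficient a vanishes at x = 0 and cannot
-- be inverted. This makes the two distributions agree without any bijection between them, and it is
-- why the closed form is established as a product identity, denominator times F equals numerator.
-- The two patterns differ only in which of u and v is capped by the largest letter, an exchange
-- that the commutative product of series does not see. Permutations are handled as lists of natural
-- numbers: raising u above v is then addition, and gluing needs no passage between the types
-- `Fin n`. The series are sums of y to the number of occurrences over one list of avoiders, taken
-- in any commutative ring; the counts `f τ r n` are compared with them only at the end.

-- Power series over a commutative ring.

module PowerSeries {c ℓ : Level} (R : CommutativeRing c ℓ) where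
  open CommutativeRing R
  open Sum +-commutativeMonoid using (sum-cong-≋)
  open CommutativeSemigroupProperties +-commutativeSemigroup using (interchange; x∙yz≈y∙xz)
  open SetoidReasoning setoid

  open RawRing (powerSeries rawRing) public using ()
    renaming ( Carrier to Seq; _≈_ to _≈ˢ_; _+_ to _+ˢ_; _*_ to _*ˢ_
             ; -_ to -ˢ_; 0# to 0ˢ; 1# to 1ˢ )

  infixr 7 _∙ˢ_
  _∙ˢ_ : Carrier → Seq → Seq
  (k ∙ˢ a) n = k * a n

  *ˢ-cong : ∀ {a a′ b b′} → a ≈ˢ a′ → b ≈ˢ b′ → a *ˢ b ≈ˢ a′ *ˢ b′
  *ˢ-cong a≈a′ b≈b′ n = sum-cong-≋ {suc n} λ i → *-cong (a≈a′ (Fin.toℕ i)) (b≈b′ (n ∸ Fin.toℕ i))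

  -- At `suc n` a product unfolds by computation to `a 0 * b (suc n)` plus the product of `a ∘ suc`
  -- and `b` at `n`. This law and the ones that follow are inductions on the degree along that
  -- recursion.
  0*ˢ : ∀ b → 0ˢ *ˢ b ≈ˢ 0ˢ
  0*ˢ b zero    = trans (+-identityʳ _) (zeroˡ _)
  0*ˢ b (suc n) = trans (+-cong (zeroˡ _) (0*ˢ b n)) (+-identityʳ _)

  *ˢ-distribʳ : ∀ a b d → (a +ˢ b) *ˢ d ≈ˢ (a *ˢ d) +ˢ (b *ˢ d)
  *ˢ-distribʳ a b d zero    = begin
    (a 0 + b 0) * d 0 + 0#                ≈⟨ +-cong (distribʳ _ _ _) (sym (+-identityʳ _)) ⟩
    (a 0 * d 0 + b 0 * d 0) + (0# + 0#)   ≈⟨ interchange _ _ _ _ ⟩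
    (a 0 * d 0 + 0#) + (b 0 * d 0 + 0#)   ∎
  *ˢ-distribʳ a b d (suc n) = begin
    (a 0 + b 0) * d (suc n) + ((a ∘ suc +ˢ b ∘ suc) *ˢ d) n
      ≈⟨ +-cong (distribʳ _ _ _) (*ˢ-distribʳ (a ∘ suc) (b ∘ suc) d n) ⟩
    (a 0 * d (suc n) + b 0 * d (suc n)) + ((a ∘ suc *ˢ d) n + (b ∘ suc *ˢ d) n)
      ≈⟨ interchange _ _ _ _ ⟩
    (a *ˢ d) (suc n) + (b *ˢ d) (suc n) ∎

  ∙ˢ-*ˢ : ∀ k a b → (k ∙ˢ a) *ˢ b ≈ˢ k ∙ˢ (a *ˢ b)
  ∙ˢ-*ˢ k a b zero    = begin
    k * a 0 * b 0 + 0#     ≈⟨ +-cong (*-assoc _ _ _) (sym (zeroʳ k)) ⟩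
    k * (a 0 * b 0) + k * 0# ≈⟨ distribˡ _ _ _ ⟨
    k * (a 0 * b 0 + 0#)   ∎
  ∙ˢ-*ˢ k a b (suc n) = begin
    k * a 0 * b (suc n) + ((k ∙ˢ (a ∘ suc)) *ˢ b) n ≈⟨ +-cong (*-assoc _ _ _) (∙ˢ-*ˢ k (a ∘ suc) b n) ⟩
    k * (a 0 * b (suc n)) + k * (a ∘ suc *ˢ b) n    ≈⟨ distribˡ _ _ _ ⟨
    k * (a *ˢ b) (suc n)                            ∎

  -- The mirror image of the defining recursion, splitting off the constant term of the right
  -- factor. Commutativity then only has to match the two recursions.
  *ˢ-suc : ∀ a b n → (a *ˢ b) (suc n) ≈ a (suc n) * b 0 + (a *ˢ (b ∘ suc)) n
  *ˢ-suc a b zero    = x∙yz≈y∙xz _ _ _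
  *ˢ-suc a b (suc n) = begin
    a 0 * b (suc (suc n)) + (a ∘ suc *ˢ b) (suc n)
      ≈⟨ +-congˡ (*ˢ-suc (a ∘ suc) b n) ⟩
    a 0 * b (suc (suc n)) + (a (suc (suc n)) * b 0 + (a ∘ suc *ˢ b ∘ suc) n)
      ≈⟨ x∙yz≈y∙xz _ _ _ ⟩
    a (suc (suc n)) * b 0 + (a *ˢ b ∘ suc) (suc n) ∎

  *ˢ-comm : ∀ a b → a *ˢ b ≈ˢ b *ˢ a
  *ˢ-comm a b zero    = +-congʳ (*-comm _ _)
  *ˢ-comm a b (suc n) = begin
    a 0 * b (suc n) + (a ∘ suc *ˢ b) n ≈⟨ +-cong (*-comm _ _) (*ˢ-comm (a ∘ suc) b n) ⟩
    b (suc n) * a 0 + (b *ˢ a ∘ suc) n ≈⟨ *ˢ-suc b a n ⟨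
    (b *ˢ a) (suc n)                   ∎

  *ˢ-assoc : ∀ a b d → (a *ˢ b) *ˢ d ≈ˢ a *ˢ (b *ˢ d)
  *ˢ-assoc a b d zero    = begin
    (a 0 * b 0 + 0#) * d 0 + 0#    ≈⟨ +-congʳ (*-congʳ (+-identityʳ _)) ⟩
    a 0 * b 0 * d 0 + 0#           ≈⟨ +-congʳ (*-assoc _ _ _) ⟩
    a 0 * (b 0 * d 0) + 0#         ≈⟨ +-congʳ (*-congˡ (+-identityʳ _)) ⟨
    a 0 * (b 0 * d 0 + 0#) + 0#    ∎
  *ˢ-assoc a b d (suc n) = begin
    -- The tail of `a *ˢ b` is by computation a scalar multiple of `b ∘ suc` plus `a ∘ suc *ˢ b`, so
    -- distributivity and `∙ˢ-*ˢ` reduce the claim to the tail of `a`.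
    (a 0 * b 0 + 0#) * d (suc n) + ((a 0 ∙ˢ b ∘ suc +ˢ a ∘ suc *ˢ b) *ˢ d) n
      ≈⟨ +-cong (trans (*-congʳ (+-identityʳ _)) (*-assoc _ _ _))
                (*ˢ-distribʳ (a 0 ∙ˢ b ∘ suc) (a ∘ suc *ˢ b) d n) ⟩
    a 0 * (b 0 * d (suc n)) + (((a 0 ∙ˢ b ∘ suc) *ˢ d) n + ((a ∘ suc *ˢ b) *ˢ d) n)
      ≈⟨ +-assoc _ _ _ ⟨
    a 0 * (b 0 * d (suc n)) + ((a 0 ∙ˢ b ∘ suc) *ˢ d) n + ((a ∘ suc *ˢ b) *ˢ d) n
      ≈⟨ +-cong (+-congˡ (∙ˢ-*ˢ (a 0) (b ∘ suc) d n)) (*ˢ-assoc (a ∘ suc) b d n) ⟩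
    a 0 * (b 0 * d (suc n)) + a 0 * (b ∘ suc *ˢ d) n + (a ∘ suc *ˢ (b *ˢ d)) n
      ≈⟨ +-congʳ (distribˡ _ _ _) ⟨
    (a *ˢ (b *ˢ d)) (suc n) ∎

  *ˢ-identityˡ : ∀ a → 1ˢ *ˢ a ≈ˢ a
  *ˢ-identityˡ a zero    = trans (+-identityʳ _) (*-identityˡ _)
  *ˢ-identityˡ a (suc n) = trans (+-cong (*-identityˡ _) (0*ˢ a n)) (+-identityʳ _)

  record IsConstant (k : Carrier) (a : Seq) : Set ℓ where
    field
      a₀≈k : a 0 ≈ k
      aₙ≈0 : ∀ n → a (suc n) ≈ 0#

  -- Converts the scalar factor y - 1 of a coefficient recurrence into the series factor `Y - 1#`.
  constant-*ˢ : ∀ {k a} → IsConstant k a → ∀ b n → (a *ˢ b) n ≈ k * b n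
  constant-*ˢ a≈k b zero    = trans (+-identityʳ _) (*-congʳ (IsConstant.a₀≈k a≈k))
  constant-*ˢ a≈k b (suc n) = trans
    (+-cong (*-congʳ (IsConstant.a₀≈k a≈k))
            (trans (*ˢ-cong {b = b} (IsConstant.aₙ≈0 a≈k) (λ _ → refl) n) (0*ˢ b n)))
    (+-identityʳ _)

  -- Coefficient `n` of a product involves `b` only up to degree `n`; this is what strong induction
  -- on the degree consumes.
  *ˢ-zero : ∀ a {b} n → (∀ j → j ≤ n → b j ≈ 0#) → (a *ˢ b) n ≈ 0#
  *ˢ-zero a zero    b≈0 = trans (+-identityʳ _) (trans (*-congˡ (b≈0 0 z≤n)) (zeroʳ _))
  *ˢ-zero a (suc n) b≈0 = trans
    (+-cong (trans (*-congˡ (b≈0 (suc n) ℕ.≤-refl)) (zeroʳ _))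
            (*ˢ-zero (a ∘ suc) n (λ j j≤n → b≈0 j (ℕ.m≤n⇒m≤1+n j≤n))))
    (+-identityʳ _)

  commutativeRing : CommutativeRing c ℓ
  commutativeRing = record
    { RawRing (powerSeries rawRing)
    ; isCommutativeRing = record
      { isRing = record
        { +-isAbelianGroup = record
          { isGroup = record
            { isMonoid = record
              { isSemigroup = record
                { isMagma = record
                  { isEquivalence = record
                    { refl  = λ _ → refl
                    ; sym   = λ a≈b n → sym (a≈b n)
                    ; trans = λ a≈b b≈d n → trans (a≈b n) (b≈d n)
                    }
                  ; ∙-cong = λ a≈a′ b≈b′ n → +-cong (a≈a′ n) (b≈b′ n)
                  }
                ; assoc = λ a b d n → +-assoc (a n) (b n) (d n)
                }
              ; identity = (λ a n → +-identityˡ (a n)) , (λ a n → +-identityʳ (a n))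
              }
            ; inverse = (λ a n → -‿inverseˡ (a n)) , (λ a n → -‿inverseʳ (a n))
            ; ⁻¹-cong = λ a≈b n → -‿cong (a≈b n)
            }
          ; comm = λ a b n → +-comm (a n) (b n)
          }
        ; *-cong = *ˢ-cong
        ; *-assoc = *ˢ-assoc
        ; *-identity = *ˢ-identityˡ , λ a n → trans (*ˢ-comm a 1ˢ n) (*ˢ-identityˡ a n)
        ; distrib = (λ a b d n → trans (*ˢ-comm a (b +ˢ d) n)
                      (trans (*ˢ-distribʳ b d a n) (+-cong (*ˢ-comm b a n) (*ˢ-comm d a n))))
                  , (λ a b d → *ˢ-distribʳ b d a)
        }
      ; *-comm = *ˢ-comm
      }
    }

  record IsVariable (v : Seq) : Set ℓ where
    field
      v₀≈0 : v 0 ≈ 0#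
      v₁≈1 : v 1 ≈ 1#
      vₙ≈0 : ∀ n → v (suc (suc n)) ≈ 0#

  module Shift (v : Seq) (v-isVariable : IsVariable v) where
    open IsVariable v-isVariable

    shift-zero : ∀ a → (v *ˢ a) 0 ≈ 0#
    shift-zero a = trans (+-identityʳ _) (trans (*-congʳ v₀≈0) (zeroˡ _))

    shift-suc : ∀ a n → (v *ˢ a) (suc n) ≈ a n
    shift-suc a n = begin
      v 0 * a (suc n) + (v ∘ suc *ˢ a) n ≈⟨ +-cong (trans (*-congʳ v₀≈0) (zeroˡ _))
                                                   (*ˢ-cong {b = a} tail≈1 (λ _ → refl) n) ⟩
      0# + (1ˢ *ˢ a) n                   ≈⟨ +-identityˡ _ ⟩
      (1ˢ *ˢ a) n                        ≈⟨ *ˢ-identityˡ a n ⟩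
      a n                                ∎
      where
      tail≈1 : v ∘ suc ≈ˢ 1ˢ
      tail≈1 zero    = v₁≈1
      tail≈1 (suc n) = vₙ≈0 n

    -- The factor `v` raises degrees by one, so each coefficient of `h` is a combination of strictly
    -- lower ones, and the constant one is zero. The first argument of `below` bounds the degree and
    -- carries the strong induction.
    shift-fixpoint : ∀ a {h} → h ≈ˢ v *ˢ (a *ˢ h) → h ≈ˢ 0ˢ
    shift-fixpoint a {h} h≈ n = below n n ℕ.≤-refl
      where
      below : ∀ n j → j ≤ n → h j ≈ 0#
      below n       zero    _         = trans (h≈ 0) (shift-zero (a *ˢ h))
      below (suc n) (suc j) (s≤s j≤n) = trans (h≈ (suc j)) (trans (shift-suc (a *ˢ h) j)
        (*ˢ-zero a j (λ i i≤j → below n i (ℕ.≤-trans i≤j j≤n))))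

module ℤ⟦y⟧ = PowerSeries ℤ.+-*-commutativeRing

-- Equality and operations of polynomials are those of their coefficient sequences by definition, so
-- all laws are pulled back along `coeff` from the power series over ℤ.
ℤ[y]-commutativeRing : CommutativeRing _ _
ℤ[y]-commutativeRing = record
  { RawRing ℤ[y]
  ; isCommutativeRing =
      RingMonomorphism.isCommutativeRing coeff-isRingMonomorphism
        (CommutativeRing.isCommutativeRing ℤ⟦y⟧.commutativeRing)
  }
  where
  module S = CommutativeRing ℤ⟦y⟧.commutativeRing
  coeff-isRingMonomorphism : IsRingMonomorphism ℤ[y] S.rawRing Polynomial.coeff
  coeff-isRingMonomorphism = record
    { isRingHomomorphism = record
      { isSemiringHomomorphism = record
        { isNearSemiringHomomorphism = record
          { +-isMonoidHomomorphism = record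
            { isMagmaHomomorphism = record
              { isRelHomomorphism = record { cong = λ p≈q → p≈q }
              ; homo = λ p q → S.refl
              }
            ; ε-homo = S.refl
            }
          ; *-homo = λ p q → S.refl
          }
        ; 1#-homo = S.refl
        }
      ; -‿homo = λ p → S.refl
      }
    ; injective = λ p≈q → p≈q
    }

module ℤ[y]⟦x⟧ = PowerSeries ℤ[y]-commutativeRing

-- A ring solver with integer coefficients for an arbitrary commutative ring.

module IntegerCoefficients {c ℓ : Level} (R : CommutativeRing c ℓ) where
  open CommutativeRing R
  open AbelianGroupProperties +-abelianGroup using (⁻¹-∙-comm)
  open RingProperties ring using (-0#≈0#; -‿distribˡ-*; -‿distribʳ-*; -‿involutive)
  open SemiringMult semiring using (1+×; ×-homo-+; ×1-homo-*) renaming (_×_ to _·_)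
  open SetoidReasoning setoid

  -- The solver has to recognise equal coefficients, and equality in `R` comes with no decision
  -- procedure; ℤ has one. With the multiple used here `1 · 1#` is `1#` by computation, so
  -- `con (ℤ.+ 1)` stands for the unit itself.
  ⟦_⟧ᶻ : ℤ → Carrier
  ⟦ ℤ.+ n      ⟧ᶻ = n · 1#
  ⟦ -[1+ n ]   ⟧ᶻ = - (suc n · 1#)

  -- `_⊖_` cancels one successor on each side. The ring counterpart inserts `1# - 1#` and hands one
  -- half to each summand.
  ⊖-homo : ∀ m n → ⟦ m ⊖ n ⟧ᶻ ≈ m · 1# - n · 1#
  ⊖-homo m       zero    = begin
    m · 1#      ≈⟨ +-identityʳ _ ⟨
    m · 1# + 0# ≈⟨ +-congˡ -0#≈0# ⟨
    m · 1# - 0# ∎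
  ⊖-homo zero    (suc n) = sym (+-identityˡ _)
  ⊖-homo (suc m) (suc n) = begin
    ⟦ suc m ⊖ suc n ⟧ᶻ             ≡⟨ ≡.cong ⟦_⟧ᶻ (ℤ.[1+m]⊖[1+n]≡m⊖n m n) ⟩
    ⟦ m ⊖ n ⟧ᶻ                     ≈⟨ ⊖-homo m n ⟩
    m · 1# - n · 1#                ≈⟨ +-congʳ (+-identityʳ _) ⟨
    m · 1# + 0# - n · 1#           ≈⟨ +-congʳ (+-congˡ (-‿inverseʳ 1#)) ⟨
    m · 1# + (1# - 1#) - n · 1#    ≈⟨ +-congʳ (+-assoc _ _ _) ⟨
    m · 1# + 1# - 1# - n · 1#      ≈⟨ +-assoc _ _ _ ⟩
    m · 1# + 1# + (- 1# - n · 1#)  ≈⟨ +-cong (+-comm _ _) (⁻¹-∙-comm _ _) ⟩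
    1# + m · 1# - (1# + n · 1#)    ≈⟨ +-cong (1+× m 1#) (-‿cong (1+× n 1#)) ⟨
    suc m · 1# - suc n · 1#        ∎

  +-homo : ∀ i j → ⟦ i ℤ.+ j ⟧ᶻ ≈ ⟦ i ⟧ᶻ + ⟦ j ⟧ᶻ
  +-homo (ℤ.+ m)  (ℤ.+ n)  = ×-homo-+ 1# m n
  +-homo (ℤ.+ m)  -[1+ n ] = ⊖-homo m (suc n)
  +-homo -[1+ m ] (ℤ.+ n)  = trans (⊖-homo n (suc m)) (+-comm _ _)
  +-homo -[1+ m ] -[1+ n ] = begin
    - (suc (suc (m ℕ.+ n)) · 1#)       ≡⟨ ≡.cong (λ k → - (suc k · 1#)) (ℕ.+-suc m n) ⟨
    - ((suc m ℕ.+ suc n) · 1#)         ≈⟨ -‿cong (×-homo-+ 1# (suc m) (suc n)) ⟩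
    - (suc m · 1# + suc n · 1#)        ≈⟨ ⁻¹-∙-comm _ _ ⟨
    - (suc m · 1#) + - (suc n · 1#)    ∎

  -‿homo : ∀ i → ⟦ ℤ.- i ⟧ᶻ ≈ - ⟦ i ⟧ᶻ
  -‿homo (ℤ.+ zero)  = sym -0#≈0#
  -‿homo (ℤ.+ suc n) = refl
  -‿homo -[1+ n ]  = sym (-‿involutive _)

  -◃-homo : ∀ n → ⟦ Sign.- ◃ n ⟧ᶻ ≈ - (n · 1#)
  -◃-homo zero    = sym -0#≈0#
  -◃-homo (suc n) = refl

  *-homo : ∀ i j → ⟦ i ℤ.* j ⟧ᶻ ≈ ⟦ i ⟧ᶻ * ⟦ j ⟧ᶻ
  *-homo (ℤ.+ m)    (ℤ.+ n)    = begin
    ⟦ Sign.+ ◃ m ℕ.* n ⟧ᶻ ≡⟨ ≡.cong ⟦_⟧ᶻ (ℤ.+◃n≡+n (m ℕ.* n)) ⟩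
    (m ℕ.* n) · 1#        ≈⟨ ×1-homo-* m n ⟩
    m · 1# * n · 1#       ∎
  *-homo (ℤ.+ m)    -[1+ n ] = begin
    ⟦ Sign.- ◃ m ℕ.* suc n ⟧ᶻ ≈⟨ -◃-homo (m ℕ.* suc n) ⟩
    - ((m ℕ.* suc n) · 1#)    ≈⟨ -‿cong (×1-homo-* m (suc n)) ⟩
    - (m · 1# * suc n · 1#)   ≈⟨ -‿distribʳ-* _ _ ⟩
    m · 1# * - (suc n · 1#)   ∎
  *-homo -[1+ m ] (ℤ.+ n)    = begin
    ⟦ Sign.- ◃ suc m ℕ.* n ⟧ᶻ ≈⟨ -◃-homo (suc m ℕ.* n) ⟩
    - ((suc m ℕ.* n) · 1#)    ≈⟨ -‿cong (×1-homo-* (suc m) n) ⟩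
    - (suc m · 1# * n · 1#)   ≈⟨ -‿distribˡ-* _ _ ⟩
    - (suc m · 1#) * n · 1#   ∎
  *-homo -[1+ m ] -[1+ n ] = begin
    (suc m ℕ.* suc n) · 1#            ≈⟨ ×1-homo-* (suc m) (suc n) ⟩
    suc m · 1# * suc n · 1#           ≈⟨ -‿involutive _ ⟨
    - - (suc m · 1# * suc n · 1#)     ≈⟨ -‿cong (-‿distribʳ-* _ _) ⟩
    - (suc m · 1# * - (suc n · 1#))   ≈⟨ -‿distribˡ-* _ _ ⟩
    - (suc m · 1#) * - (suc n · 1#)   ∎

  morphism : ℤ.+-*-rawRing -Raw-AlmostCommutative⟶ fromCommutativeRing R
  morphism = record
    { ⟦_⟧    = ⟦_⟧ᶻ
    ; +-homo = +-homo
    ; *-homo = *-homo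
    ; -‿homo = -‿homo
    ; 0-homo = refl
    ; 1-homo = refl
    }

  open RingSolver ℤ.+-*-rawRing (fromCommutativeRing R) morphism
    (λ i j → Maybe.map (λ i≡j → reflexive (≡.cong ⟦_⟧ᶻ i≡j)) (dec⇒maybe (i ℤ.≟ j)))
    public using (solve; con; _:=_; _:+_; _:*_; _:-_; :-_; _:^_; _:×_)

-- Ring identities around the quadratic equation.

module Quadratic {c ℓ : Level} (R : CommutativeRing c ℓ) where
  open CommutativeRing R
  open RawSemiringDefinitions (RawRing.rawSemiring rawRing) using (_^_) renaming (_×_ to _·_)
  open IntegerCoefficients R
  open AbelianGroupProperties +-abelianGroup using (x≈y⇒x∙y⁻¹≈ε)

  -- The way a hypothesis reaches the solver, which proves identities only: the difference of the
  -- two sides of the goal is exhibited as a multiple `u` of the difference of the two sides of the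
  -- hypothesis.
  modulo : ∀ {x y l r} → l ≈ r → ∀ u → x ≈ y + u * (l - r) → x ≈ y
  modulo l≈r u x≈ = trans x≈ (trans
    (+-congˡ (trans (*-congˡ (x≈y⇒x∙y⁻¹≈ε l≈r)) (zeroʳ u))) (+-identityʳ _))

  -- Multiply the equation for P by X F² and replace X F P by F - 1.
  eliminate : ∀ X Y P F →
    P ≈ 1# + X * (P * P + (Y - 1#) * (P - 1#)) →
    F ≈ 1# + X * (F * P) →
    (1# + X * Y - X) * F ≈ 1# + X * (X + Y - X * Y) * (F * F)
  eliminate X Y P F P≈ F≈ =
    -- X F P occurs squared, so this cofactor contains the defect `F - (1# + X * (F * P))` itself.
    modulo F≈ (1# + 1# + (F - (1# + X * (F * P))) - F - (Y - 1#) * X * F)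
      (modulo P≈ (X * (F * F))
        (solve 4 (λ X Y P F →
          let one = con (ℤ.+ 1)
              p = P :- (one :+ X :* (P :* P :+ (Y :- one) :* (P :- one)))
              f = F :- (one :+ X :* (F :* P))
          in (one :+ X :* Y :- X) :* F :=
             one :+ X :* (X :+ Y :- X :* Y) :* (F :* F) :+
             (one :+ one :+ f :- F :- (Y :- one) :* X :* F) :* f :+
             X :* (F :* F) :* p)
          refl X Y P F))

  discriminant : ∀ X Y F →
    (1# + X * Y - X) * F ≈ 1# + X * (X + Y - X * Y) * (F * F) →
    (1# + X * Y - X - 2 · X * (X + Y - X * Y) * F) ^ 2 ≈
      1# - 2 · X - 3 · X ^ 2 - X * Y * (2 · 1# - 2 · X - X * Y)
  discriminant X Y F bF≈ =
    -- With a = X (X + Y - X Y) and b = 1 + X Y - X, the square is b² - 4a - 4a (b F - 1 - a F²),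
    -- and the radicand is b² - 4a written out.
    modulo bF≈ (- (4 · (X * (X + Y - X * Y))))
      (solve 3 (λ X Y F →
        let one = con (ℤ.+ 1)
            a = X :* (X :+ Y :- X :* Y)
            b = one :+ X :* Y :- X
        in (b :- 2 :× X :* (X :+ Y :- X :* Y) :* F) :^ 2 :=
           one :- 2 :× X :- 3 :× (X :^ 2) :- X :* Y :* (2 :× one :- 2 :× X :- X :* Y) :+
           :- (4 :× a) :* (b :* F :- (one :+ a :* (F :* F))))
        refl X Y F)

  -- Subtract the two equations and factor F² - G² as (F + G)(F - G). Since b is 1 - X (1 - Y) and
  -- the leading coefficient is a multiple of X, everything apart from F - G carries the factor X.
  difference : ∀ X Y F G →
    (1# + X * Y - X) * F ≈ 1# + X * (X + Y - X * Y) * (F * F) →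
    (1# + X * Y - X) * G ≈ 1# + X * (X + Y - X * Y) * (G * G) →
    F - G ≈ X * ((1# - Y + (X + Y - X * Y) * (F + G)) * (F - G))
  difference X Y F G bF≈ bG≈ =
    modulo bF≈ 1# (modulo bG≈ (- 1#)
      (solve 4 (λ X Y F G →
        let one = con (ℤ.+ 1)
            c = X :+ Y :- X :* Y
            b = one :+ X :* Y :- X
        in F :- G :=
           X :* ((one :- Y :+ c :* (F :+ G)) :* (F :- G)) :+
           one :* (b :* F :- (one :+ X :* c :* (F :* F))) :+
           :- one :* (b :* G :- (one :+ X :* c :* (G :* G))))
        refl X Y F G))

  quotient : ∀ b D F → D * F ≈ b - (b - D * F)
  quotient = solve 3 (λ b D F → D :* F := b :- (b :- D :* F)) refl

  -- Collects all but the leading 1 behind a factor X, so that the constant term can be read off.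
  root-expansion : ∀ X Y F →
    1# + X * Y - X - 2 · X * (X + Y - X * Y) * F ≈ 1# + X * (Y - 1# - 2 · 1# * (X + Y - X * Y) * F)
  root-expansion = solve 3 (λ X Y F →
    let one = con (ℤ.+ 1)
        c = X :+ Y :- X :* Y
    in one :+ X :* Y :- X :- 2 :× X :* c :* F := one :+ X :* (Y :- one :- 2 :× one :* c :* F)) refl

-- Permutations as lists of natural numbers, and their decomposition at the largest letter.

module Words where
  open import Data.Nat.Base using (_+_)
  open import Data.Nat.Properties
  open CommutativeSemigroupProperties +-commutativeSemigroup using (xy∙z≈xz∙y)
  open import Relation.Binary.PropositionalEquality hiding ([_])

  private variable
    A B : Set
    k m n p q r x : ℕ
    u v w : List ℕ

  interval : ℕ → ℕ → List ℕ
  interval k zero    = []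
  interval k (suc n) = k ∷ interval (suc k) n

  ∈-interval⁺ : ∀ n → k ≤ x → x < k + n → x ∈ interval k n
  ∈-interval⁺ {k} {x} zero    k≤x x<k = contradiction (subst (x <_) (+-identityʳ k) x<k) (≤⇒≯ k≤x)
  ∈-interval⁺ {k} {x} (suc n) k≤x x<k+1+n with m≤n⇒m<n∨m≡n k≤x
  ... | inj₁ k<x  = there (∈-interval⁺ n k<x (subst (x <_) (+-suc k n) x<k+1+n))
  ... | inj₂ refl = here refl

  ∈-interval⁻ : ∀ n → x ∈ interval k n → k ≤ x × x < k + n
  ∈-interval⁻ {k = k} (suc n) (here refl) = ≤-refl , m<m+n k (s≤s z≤n)
  ∈-interval⁻ {x} {k} (suc n) (there x∈) with ∈-interval⁻ n x∈
  ... | k<x , x<k+n = <⇒≤ k<x , subst (x <_) (sym (+-suc k n)) x<k+n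

  interval-unique : ∀ k n → Unique (interval k n)
  interval-unique k zero    = []
  interval-unique k (suc n) =
    All.tabulate (λ x∈ k≡x → <⇒≢ (proj₁ (∈-interval⁻ n x∈)) k≡x) ∷ interval-unique (suc k) n

  length-interval : ∀ k n → length (interval k n) ≡ n
  length-interval k zero    = refl
  length-interval k (suc n) = cong suc (length-interval (suc k) n)

  interval-++ : ∀ k p q → interval k (p + q) ≡ interval k p ++ interval (k + p) q
  interval-++ k zero    q = cong (λ j → interval j q) (sym (+-identityʳ k))
  interval-++ k (suc p) q = cong (k ∷_) (trans (interval-++ (suc k) p q)
    (cong (λ j → interval (suc k) p ++ interval j q) (sym (+-suc k p))))

  map-+-interval : ∀ j k n → map (j +_) (interval k n) ≡ interval (j + k) n
  map-+-interval j k zero    = refl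
  map-+-interval j k (suc n) = cong (j + k ∷_)
    (trans (map-+-interval j (suc k) n) (cong (λ i → interval i n) (+-suc j k)))

  -- Phrased with sublists instead of positions, so that avoidance passes to parts of a word by
  -- transitivity of `_⊆_`.
  Avoids : List ℕ → Set
  Avoids w = ∀ {a b c} → a ∷ b ∷ c ∷ [] ⊆ w → a < c → ¬ c < b

  Avoids-⊆ : u ⊆ w → Avoids w → Avoids u
  Avoids-⊆ u⊆w avoids abc⊆u = avoids (⊆-trans abc⊆u u⊆w)

  Avoiding : ℕ → List ℕ → Set
  Avoiding n w = w ↭ interval 0 n × Avoids w

  Avoiding-length : Avoiding n w → length w ≡ n
  Avoiding-length (w↭ , _) = trans (↭-length w↭) (length-interval 0 _)

  Avoiding-< : Avoiding n w → x ∈ w → x < n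
  Avoiding-< (w↭ , _) x∈w = proj₂ (∈-interval⁻ _ (∈-resp-↭ w↭ x∈w))

  -- In a 132-avoiding permutation every letter before the largest one exceeds
  -- every letter after it; `length v +_` makes room for v below u.
  glue : List ℕ → List ℕ → List ℕ
  glue u v = map (length v +_) u ++ (length u + length v) ∷ v

  length-glue : ∀ u v → length (glue u v) ≡ suc (length u + length v)
  length-glue u v = begin
    length (glue u v)                                ≡⟨ List.length-++ (map (length v +_) u) ⟩
    length (map (length v +_) u) + suc (length v)    ≡⟨ cong (_+ suc (length v)) (List.length-map (length v +_) u) ⟩
    length u + suc (length v)                        ≡⟨ +-suc (length u) (length v) ⟩
    suc (length u + length v)                        ∎
    where open ≡-Reasoning

  split-⊆ : ∀ (xs : List A) {ys zs} → zs ⊆ xs ++ ys →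
            ∃₂ λ zs₁ zs₂ → zs ≡ zs₁ ++ zs₂ × zs₁ ⊆ xs × zs₂ ⊆ ys
  split-⊆ []       zs⊆ = [] , _ , refl , [] , zs⊆
  split-⊆ (x ∷ xs) (.x ∷ʳ zs⊆) with split-⊆ xs zs⊆
  ... | zs₁ , zs₂ , eq , zs₁⊆ , zs₂⊆ = zs₁ , zs₂ , eq , x ∷ʳ zs₁⊆ , zs₂⊆
  split-⊆ (x ∷ xs) (refl ∷ zs⊆) with split-⊆ xs zs⊆
  ... | zs₁ , zs₂ , eq , zs₁⊆ , zs₂⊆ = x ∷ zs₁ , zs₂ , cong (x ∷_) eq , refl ∷ zs₁⊆ , zs₂⊆

  head-∈ : ∀ {x : A} {xs ys} → x ∷ xs ⊆ ys → x ∈ ys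
  head-∈ (_ ∷ʳ x⊆)  = there (head-∈ x⊆)
  head-∈ (refl ∷ _) = here refl

  -- Sort a possible occurrence by how many of its letters lie in `u`. The largest letter can be
  -- neither `a` nor `c`; and if `a` is in `u` and `c` in `v`, then c < a. Only occurrences inside
  -- `u` or inside `v` remain.
  Avoids-max : ∀ u {m v} → Avoids u → Avoids v → (∀ {a} → a ∈ u → a < m) → (∀ {c} → c ∈ v → c < m) →
               (∀ {a c} → a ∈ u → c ∈ v → c < a) → Avoids (u ++ m ∷ v)
  Avoids-max u {m} {v} u-avoids v-avoids u<m v<m v<u abc⊆ a<c c<b with split-⊆ u abc⊆
  ... | [] , _ , refl , _ , _ ∷ʳ abc⊆v = v-avoids abc⊆v a<c c<b
  ... | [] , _ , refl , _ , refl ∷ bc⊆v = <-asym a<c (v<m (head-∈ (Sublist.∷ˡ⁻ bc⊆v)))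
  ... | _ ∷ [] , _ , refl , a⊆u , bc⊆ = <-asym a<c (v<u (head-∈ a⊆u) (head-∈ (Sublist.∷⁻ bc⊆)))
  ... | _ ∷ b ∷ [] , _ , refl , ab⊆u , _ ∷ʳ c⊆v = <-asym a<c (v<u (head-∈ ab⊆u) (head-∈ c⊆v))
  ... | _ ∷ b ∷ [] , _ , refl , ab⊆u , refl ∷ _ = <-asym c<b (u<m (head-∈ (Sublist.∷ˡ⁻ ab⊆u)))
  ... | _ ∷ _ ∷ _ ∷ [] , [] , refl , abc⊆u , _ = u-avoids abc⊆u a<c c<b

  Avoids-map-+ : ∀ j u → Avoids u → Avoids (map (j +_) u)
  Avoids-map-+ j u avoids abc⊆ a<c c<b with preimage u abc⊆
    where
    preimage : ∀ u {zs} → zs ⊆ map (j +_) u → ∃ λ ys → zs ≡ map (j +_) ys × ys ⊆ u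
    preimage []      []        = [] , refl , []
    preimage (x ∷ u) (_ ∷ʳ zs⊆) with preimage u zs⊆
    ... | ys , eq , ys⊆ = ys , eq , x ∷ʳ ys⊆
    preimage (x ∷ u) (refl ∷ zs⊆) with preimage u zs⊆
    ... | ys , eq , ys⊆ = x ∷ ys , cong (j + x ∷_) eq , refl ∷ ys⊆
  ... | _ ∷ _ ∷ _ ∷ [] , refl , abc⊆u = avoids abc⊆u (+-cancelˡ-< j _ _ a<c) (+-cancelˡ-< j _ _ c<b)

  Avoids-map-+⁻ : ∀ j u → Avoids (map (j +_) u) → Avoids u
  Avoids-map-+⁻ j u avoids abc⊆u a<c c<b =
    avoids (Sublist.map⁺ (j +_) abc⊆u) (+-monoʳ-< j a<c) (+-monoʳ-< j c<b)

  glue-avoiding : Avoiding p u → Avoiding q v → Avoiding (suc (p + q)) (glue u v)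
  glue-avoiding {p} {u} {q} {v} av-u@(u↭ , u-avoids) av-v@(v↭ , v-avoids)
    with refl ← Avoiding-length av-u | refl ← Avoiding-length av-v =
      glue↭ , Avoids-max u⁺ (Avoids-map-+ q u u-avoids) v-avoids u⁺<p+q
                (λ c∈v → m≤n⇒m≤o+n p (Avoiding-< av-v c∈v)) v<u⁺
    where
    u⁺ = map (q +_) u
    u⁺<p+q : ∀ {a} → a ∈ u⁺ → a < p + q
    u⁺<p+q a∈ with ∈-map⁻ (q +_) a∈
    ... | a , a∈u , refl = subst (q + a <_) (+-comm q p) (+-monoʳ-< q (Avoiding-< av-u a∈u))
    v<u⁺ : ∀ {a c} → a ∈ u⁺ → c ∈ v → c < a
    v<u⁺ a∈ c∈v with ∈-map⁻ (q +_) a∈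
    ... | a , a∈u , refl = m≤n⇒m≤n+o a (Avoiding-< av-v c∈v)
    open PermutationReasoning
    glue↭ : glue u v ↭ interval 0 (suc (p + q))
    glue↭ = begin
      u⁺ ++ (p + q) ∷ v                             ↭⟨ shift (p + q) u⁺ v ⟩
      (p + q) ∷ u⁺ ++ v                             ↭⟨ ↭-prep (p + q) (++⁺ (Perm.map⁺ (q +_) u↭) v↭) ⟩
      (p + q) ∷ map (q +_) (interval 0 p) ++ interval 0 q
        ≡⟨ cong (λ xs → (p + q) ∷ xs ++ interval 0 q)
             (trans (map-+-interval q 0 p) (cong (λ j → interval j p) (+-identityʳ q))) ⟩
      (p + q) ∷ interval q p ++ interval 0 q        ↭⟨ ++-comm ((p + q) ∷ interval q p) (interval 0 q) ⟩
      interval 0 q ++ (p + q) ∷ interval q p        ↭⟨ shift (p + q) (interval 0 q) (interval q p) ⟩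
      (p + q) ∷ interval 0 q ++ interval q p        ≡⟨ cong ((p + q) ∷_) (interval-++ 0 q p) ⟨
      (p + q) ∷ interval 0 (q + p)                  ≡⟨ cong (λ j → (p + q) ∷ interval 0 j) (+-comm q p) ⟩
      (p + q) ∷ interval 0 (p + q)                  ↭⟨ ++-comm [ p + q ] (interval 0 (p + q)) ⟩
      interval 0 (p + q) ++ [ p + q ]               ≡⟨ interval-++ 0 (p + q) 1 ⟨
      interval 0 (p + q + 1)                        ≡⟨ cong (interval 0) (+-comm (p + q) 1) ⟩
      interval 0 (suc (p + q))                      ∎

  -- The least letter `k` must lie in `v`, for in `u` it would have to exceed a letter of `v`.
  -- Delete it and continue with `suc k`, by induction on the length of `v`.
  ++↭interval : ∀ q → length v ≡ q → u ++ v ↭ interval k (q + p) →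
                (∀ {a c} → a ∈ u → c ∈ v → c < a) →
                v ↭ interval k q × u ↭ interval (k + q) p
  ++↭interval {[]} {u} {k} {p} zero _ u++v↭ _ =
    ↭-refl , subst₂ _↭_ (List.++-identityʳ u) (cong (λ j → interval j p) (sym (+-identityʳ k))) u++v↭
  ++↭interval {v@(c ∷ _)} {u} {k} {p} (suc q) |v|≡ u++v↭ v<u
    with ∈-++⁻ u (∈-resp-↭ (↭-sym u++v↭) (here refl))
  ... | inj₁ k∈u = contradiction (v<u k∈u (here refl))
                     (≤⇒≯ (proj₁ (∈-interval⁻ (suc q + p) (∈-resp-↭ u++v↭ (∈-++⁺ʳ u (here refl))))))
  ... | inj₂ k∈v with v₁ , v₂ , eq ← ∈-∃++ k∈v =
    ↭-trans (↭-reflexive eq) (↭-trans (shift k v₁ v₂) (↭-prep k (proj₁ rest))) ,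
    subst (λ j → u ↭ interval j p) (sym (+-suc k q)) (proj₂ rest)
    where
    v↭ : v ↭ k ∷ v₁ ++ v₂
    v↭ = ↭-trans (↭-reflexive eq) (shift k v₁ v₂)
    rest : v₁ ++ v₂ ↭ interval (suc k) q × u ↭ interval (suc k + q) p
    rest = ++↭interval q
      (suc-injective (trans (sym (↭-length v↭)) |v|≡))
      (subst (_↭ interval (suc k) (q + p)) (List.++-assoc u v₁ v₂)
        (drop-mid (u ++ v₁) [] (subst (_↭ interval k (suc (q + p)))
          (trans (cong (u ++_) eq) (sym (List.++-assoc u v₁ (k ∷ v₂)))) u++v↭)))
      (λ a∈ c∈ → v<u a∈ (∈-resp-↭ (↭-sym v↭) (there c∈)))

  Unique-++-disjoint : ∀ (xs : List A) {ys x} → Unique (xs ++ ys) → x ∈ xs → x ∉ ys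
  Unique-++-disjoint (_ ∷ xs) (x≢ ∷ _)  (here refl) x∈ys = All.lookup x≢ (∈-++⁺ʳ xs x∈ys) refl
  Unique-++-disjoint (_ ∷ xs) (_ ∷ xs!) (there x∈xs)     = Unique-++-disjoint xs xs! x∈xs

  map-+-∸ : ∀ j u → (∀ {a} → a ∈ u → j ≤ a) → map (j +_) (map (_∸ j) u) ≡ u
  map-+-∸ j []      j≤u = refl
  map-+-∸ j (a ∷ u) j≤u = cong₂ _∷_ (m+[n∸m]≡n (j≤u (here refl))) (map-+-∸ j u (j≤u ∘ there))

  map-∸-interval : ∀ j n → map (_∸ j) (interval j n) ≡ interval 0 n
  map-∸-interval j n = begin
    map (_∸ j) (interval j n)                  ≡⟨ cong (λ i → map (_∸ j) (interval i n)) (+-identityʳ j) ⟨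
    map (_∸ j) (interval (j + 0) n)            ≡⟨ cong (map (_∸ j)) (map-+-interval j 0 n) ⟨
    map (_∸ j) (map (j +_) (interval 0 n))     ≡⟨ List.map-∘ (interval 0 n) ⟨
    map (λ i → (j + i) ∸ j) (interval 0 n)     ≡⟨ List.map-cong (m+n∸m≡n j) (interval 0 n) ⟩
    map id (interval 0 n)                      ≡⟨ List.map-id (interval 0 n) ⟩
    interval 0 n                               ∎
    where open ≡-Reasoning

  unglue : Avoiding (suc n) w →
           ∃₂ λ u v → Avoiding (length u) u × Avoiding (length v) v ×
                      length u + length v ≡ n × w ≡ glue u v
  unglue {n} {w} (w↭ , avoids) with ∈-∃++ (∈-resp-↭ (↭-sym w↭) (∈-interval⁺ (suc n) z≤n ≤-refl))
  ... | u , v , refl = u⁻ , v , (u⁻↭ , u⁻-avoids) , (v↭ , v-avoids) , |u⁻|+|v|≡n , w≡glue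
    where
    |v| = length v
    u⁻ = map (_∸ |v|) u
    |u⁻|≡|u| : length u⁻ ≡ length u
    |u⁻|≡|u| = List.length-map (_∸ |v|) u
    interval↭ : interval 0 (suc n) ↭ n ∷ interval 0 n
    interval↭ = ↭-trans (↭-reflexive (trans (cong (interval 0) (+-comm 1 n)) (interval-++ 0 n 1)))
                        (++-comm (interval 0 n) [ n ])
    u++v↭ : u ++ v ↭ interval 0 n
    u++v↭ = drop-mid u [] (↭-trans w↭ interval↭)
    |u|+|v|≡n : length u + |v| ≡ n
    |u|+|v|≡n = trans (sym (List.length-++ u)) (trans (↭-length u++v↭) (length-interval 0 n))
    |u⁻|+|v|≡n : length u⁻ + |v| ≡ n
    |u⁻|+|v|≡n = trans (cong (_+ |v|) |u⁻|≡|u|) |u|+|v|≡n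
    u++v-unique : Unique (u ++ v)
    u++v-unique = SetoidPerm.Unique-resp-↭ (setoid ℕ) (↭⇒↭ₛ (↭-sym u++v↭)) (interval-unique 0 n)
    v<u : ∀ {a c} → a ∈ u → c ∈ v → c < a
    -- If a < c, then `a`, `n`, `c` would be an occurrence of 1-3-2; equality is excluded because
    -- the letters are distinct.
    v<u a∈u c∈v = ≤∧≢⇒< (≮⇒≥ λ a<c → avoids
        (Sublist.++⁺ (Sublist.from∈ a∈u) (refl ∷ Sublist.from∈ c∈v))
        a<c (proj₂ (∈-interval⁻ n (∈-resp-↭ u++v↭ (∈-++⁺ʳ u c∈v)))))
      (λ { refl → Unique-++-disjoint u u++v-unique a∈u c∈v })
    halves : v ↭ interval 0 |v| × u ↭ interval |v| (length u)
    halves = ++↭interval |v| refl (subst (λ j → u ++ v ↭ interval 0 j)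
               (trans (sym |u|+|v|≡n) (+-comm (length u) |v|)) u++v↭) v<u
    v↭ = proj₁ halves
    u↭ = proj₂ halves
    u⁻↭ : u⁻ ↭ interval 0 (length u⁻)
    u⁻↭ = ↭-trans (Perm.map⁺ (_∸ |v|) u↭) (↭-reflexive
            (trans (map-∸-interval |v| (length u)) (cong (interval 0) (sym |u⁻|≡|u|))))
    |v|+u⁻≡u : map (|v| +_) u⁻ ≡ u
    |v|+u⁻≡u = map-+-∸ |v| u (λ a∈ → proj₁ (∈-interval⁻ (length u) (∈-resp-↭ u↭ a∈)))
    u-avoids : Avoids u
    u-avoids = Avoids-⊆ (Sublist.++⁺ʳ (n ∷ v) ⊆-refl) avoids
    u⁻-avoids : Avoids u⁻
    u⁻-avoids = Avoids-map-+⁻ |v| u⁻ (subst Avoids (sym |v|+u⁻≡u) u-avoids)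
    v-avoids : Avoids v
    v-avoids = Avoids-⊆ (Sublist.++⁺ˡ u (n ∷ʳ ⊆-refl)) avoids
    w≡glue : u ++ [ n ] ++ v ≡ glue u⁻ v
    w≡glue = cong₂ (λ xs m → xs ++ m ∷ v) (sym |v|+u⁻≡u) (sym |u⁻|+|v|≡n)

  ++-∷-injective : ∀ {m} (u u′ : List A) {v v′} → m ∉ u → m ∉ u′ →
                   u ++ m ∷ v ≡ u′ ++ m ∷ v′ → u ≡ u′ × v ≡ v′
  ++-∷-injective []      []        _   _    refl = refl , refl
  ++-∷-injective []      (_ ∷ _)   _   m∉u′ refl = contradiction (here refl) m∉u′
  ++-∷-injective (_ ∷ _) []        m∉u _    refl = contradiction (here refl) m∉u
  ++-∷-injective (_ ∷ u) (_ ∷ u′)  m∉u m∉u′ eq with refl , eq′ ← List.∷-injective eq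
    with refl , refl ← ++-∷-injective u u′ (m∉u ∘ there) (m∉u′ ∘ there) eq′ = refl , refl

  max∉ : ∀ u (v : List ℕ) → Avoiding p u → length u + length v ∉ map (length v +_) u
  max∉ u v av-u m∈ with ∈-map⁻ (length v +_) m∈
  ... | a , a∈u , m≡ = <⇒≢ (subst (a <_) (sym (Avoiding-length av-u)) (Avoiding-< av-u a∈u))
    (+-cancelʳ-≡ (length v) a (length u) (trans (+-comm a (length v)) (sym m≡)))

  -- Equal lengths give equal largest letters. That letter does not occur in the raised left part,
  -- so the cut is determined; equal right parts then mean equal shifts.
  glue-injective : ∀ {u v u′ v′ p′} → Avoiding p u → Avoiding p′ u′ → glue u v ≡ glue u′ v′ → u ≡ u′ × v ≡ v′
  glue-injective {u = u} {v} {u′} {v′} av-u av-u′ eq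
    with max≡ ← suc-injective (trans (sym (length-glue u v)) (trans (cong length eq) (length-glue u′ v′)))
    with u⁺≡ , refl ← ++-∷-injective {m = length u + length v} (map (length v +_) u) (map (length v′ +_) u′)
           (max∉ u v av-u) (subst (_∉ map (length v′ +_) u′) (sym max≡) (max∉ u′ v′ av-u′))
           (trans eq (cong (λ m → map (length v′ +_) u′ ++ m ∷ v′) (sym max≡)))
    = List.map-injective (λ {a} {b} → +-cancelˡ-≡ (length v) a b) u⁺≡ , refl

  -- Occurrences of the two patterns in glued words.

  <ᵇ-true : ∀ {a b} → a < b → (a <ᵇ b) ≡ true
  <ᵇ-true {zero}  (s≤s a≤b) = refl
  <ᵇ-true {suc a} (s≤s a<b) = <ᵇ-true a<b

  <ᵇ-false : ∀ {a b} → b ≤ a → (a <ᵇ b) ≡ false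
  <ᵇ-false z≤n       = refl
  <ᵇ-false (s≤s b≤a) = <ᵇ-false b≤a

  +-<ᵇ : ∀ j a b → (j + a <ᵇ j + b) ≡ (a <ᵇ b)
  +-<ᵇ zero    a b = refl
  +-<ᵇ (suc j) a b = +-<ᵇ j a b

  indicator : Bool → ℕ
  indicator true  = 1
  indicator false = 0

  -- Built on `_<ᵇ_` so that a known comparison can be rewritten, and so that it coincides by
  -- computation with the decision `matches?` on letters of `Fin n`.
  matches : Pattern → ℕ → ℕ → ℕ → Bool
  matches p123 a b c = (a <ᵇ b) ∧ (b <ᵇ c)
  matches p321 a b c = (b <ᵇ a) ∧ (c <ᵇ b)

  occ : Pattern → List ℕ → ℕ
  occ τ (a ∷ b ∷ c ∷ w) = indicator (matches τ a b c) + occ τ (b ∷ c ∷ w)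
  occ τ _               = 0

  -- The number of occurrences gained by putting a larger letter in front of w
  -- (τ = 321), respectively after w (τ = 123).
  gain : Pattern → List ℕ → ℕ
  gain p321 (a ∷ b ∷ _)     = indicator (b <ᵇ a)
  gain p321 _               = 0
  gain p123 (a ∷ b ∷ [])    = indicator (a <ᵇ b)
  gain p123 (_ ∷ b ∷ c ∷ w) = gain p123 (b ∷ c ∷ w)
  gain p123 _               = 0

  -- The exponent of y in P. Going through `gain` makes it independent of a choice of the added
  -- letter.
  capped : Pattern → List ℕ → ℕ
  capped τ w = occ τ w + gain τ w

  nonempty : List ℕ → ℕ
  nonempty []      = 0
  nonempty (_ ∷ _) = 1

  matches-map-+ : ∀ τ j a b c → matches τ (j + a) (j + b) (j + c) ≡ matches τ a b c
  matches-map-+ p123 j a b c = cong₂ _∧_ (+-<ᵇ j a b) (+-<ᵇ j b c)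
  matches-map-+ p321 j a b c = cong₂ _∧_ (+-<ᵇ j b a) (+-<ᵇ j c b)

  occ-map-+ : ∀ τ j w → occ τ (map (j +_) w) ≡ occ τ w
  occ-map-+ τ j []              = refl
  occ-map-+ τ j (_ ∷ [])        = refl
  occ-map-+ τ j (_ ∷ _ ∷ [])    = refl
  occ-map-+ τ j (a ∷ b ∷ c ∷ w) =
    cong₂ _+_ (cong indicator (matches-map-+ τ j a b c)) (occ-map-+ τ j (b ∷ c ∷ w))

  gain-map-+ : ∀ τ j w → gain τ (map (j +_) w) ≡ gain τ w
  gain-map-+ p321 j []              = refl
  gain-map-+ p321 j (_ ∷ [])        = refl
  gain-map-+ p321 j (a ∷ b ∷ _)     = cong indicator (+-<ᵇ j b a)
  gain-map-+ p123 j []              = refl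
  gain-map-+ p123 j (_ ∷ [])        = refl
  gain-map-+ p123 j (a ∷ b ∷ [])    = cong indicator (+-<ᵇ j a b)
  gain-map-+ p123 j (_ ∷ b ∷ c ∷ w) = gain-map-+ p123 j (b ∷ c ∷ w)

  capped-map-+ : ∀ τ j w → capped τ (map (j +_) w) ≡ capped τ w
  capped-map-+ τ j w = cong₂ _+_ (occ-map-+ τ j w) (gain-map-+ τ j w)

  nonempty-map-+ : ∀ j w → nonempty (map (j +_) w) ≡ nonempty w
  nonempty-map-+ j []      = refl
  nonempty-map-+ j (_ ∷ _) = refl

  matches-peak : ∀ τ {a m c} → a < m → c < m → matches τ a m c ≡ false
  matches-peak p123 {a} {m} a<m c<m rewrite <ᵇ-false (<⇒≤ c<m) = Bool.∧-zeroʳ (a <ᵇ m)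
  matches-peak p321         a<m c<m rewrite <ᵇ-false (<⇒≤ a<m) = refl

  -- A window of three letters that ends at `m` or earlier lies in `u ++ [ m ]`, one that starts at
  -- `m` or later lies in `m ∷ v`. The only other window is centred at `m`, and there neither
  -- pattern matches.
  occ-peak : ∀ τ u {m} v → All (_< m) u → All (_< m) v →
             occ τ (u ++ m ∷ v) ≡ occ τ (u ++ [ m ]) + occ τ (m ∷ v)
  occ-peak τ []              v       _ _ = refl
  occ-peak τ (a ∷ [])        []      _ _ = refl
  occ-peak τ (a ∷ [])        (c ∷ v) (a<m ∷ []) (c<m ∷ _) rewrite matches-peak τ a<m c<m = refl
  occ-peak τ (a ∷ b ∷ [])    {m} v (_ ∷ b<m) v<m = trans
    (cong (indicator (matches τ a b m) +_) (occ-peak τ (b ∷ []) v b<m v<m))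
    (sym (+-assoc (indicator (matches τ a b m)) _ _))
  occ-peak τ (a ∷ b ∷ c ∷ u) v (_ ∷ u<m) v<m = trans
    (cong (indicator (matches τ a b c) +_) (occ-peak τ (b ∷ c ∷ u) v u<m v<m))
    (sym (+-assoc (indicator (matches τ a b c)) _ _))

  occ-max-∷-321 : ∀ {v} → All (_< m) v → occ p321 (m ∷ v) ≡ capped p321 v
  occ-max-∷-321 []            = refl
  occ-max-∷-321 (_ ∷ [])      = refl
  occ-max-∷-321 {v = a ∷ b ∷ v} (a<m ∷ _ ∷ _) rewrite <ᵇ-true a<m =
    +-comm (indicator (b <ᵇ a)) (occ p321 (a ∷ b ∷ v))

  occ-∷ʳ-max-123 : ∀ u → All (_< m) u → occ p123 (u ++ [ m ]) ≡ capped p123 u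
  occ-∷ʳ-max-123 []              _ = refl
  occ-∷ʳ-max-123 (_ ∷ [])        _ = refl
  occ-∷ʳ-max-123 (a ∷ b ∷ [])    (_ ∷ b<m ∷ _) rewrite <ᵇ-true b<m | Bool.∧-identityʳ (a <ᵇ b) = +-identityʳ _
  occ-∷ʳ-max-123 (a ∷ b ∷ c ∷ u) (_ ∷ u<m) = trans
    (cong (indicator (matches p123 a b c) +_) (occ-∷ʳ-max-123 (b ∷ c ∷ u) u<m))
    (sym (+-assoc (indicator (matches p123 a b c)) _ _))

  occ-max-∷-123 : ∀ {v} → All (_< m) v → occ p123 (m ∷ v) ≡ occ p123 v
  occ-max-∷-123 []            = refl
  occ-max-∷-123 (_ ∷ [])      = refl
  occ-max-∷-123 {v = a ∷ b ∷ v} (a<m ∷ _ ∷ _) rewrite <ᵇ-false (<⇒≤ a<m) = refl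

  occ-∷ʳ-max-321 : ∀ u → All (_< m) u → occ p321 (u ++ [ m ]) ≡ occ p321 u
  occ-∷ʳ-max-321 []              _ = refl
  occ-∷ʳ-max-321 (_ ∷ [])        _ = refl
  occ-∷ʳ-max-321 (a ∷ b ∷ [])    (_ ∷ b<m ∷ _)
    rewrite <ᵇ-false (<⇒≤ b<m) | Bool.∧-zeroʳ (b <ᵇ a) = refl
  occ-∷ʳ-max-321 (a ∷ b ∷ c ∷ u) (_ ∷ u<m) =
    cong (indicator (matches p321 a b c) +_) (occ-∷ʳ-max-321 (b ∷ c ∷ u) u<m)

  -- Only the first two letters matter. If `u` is empty they are `a` and `m`, an ascent, which
  -- yields 0 just as a single letter does.
  gain-∷-321 : ∀ {a} u v → All (_< m) (a ∷ u) → gain p321 (a ∷ u ++ m ∷ v) ≡ gain p321 (a ∷ u)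
  gain-∷-321 []      v (a<m ∷ []) = cong indicator (<ᵇ-false (<⇒≤ a<m))
  gain-∷-321 (_ ∷ _) v _          = refl

  -- The added letter, `m` and the first letter of `v` always descend. This extra occurrence for
  -- nonempty `v` is the source of the term (y - 1)(P - 1).
  gain-max-∷-321 : ∀ v → All (_< m) v → gain p321 (m ∷ v) ≡ nonempty v
  gain-max-∷-321 []      _         = refl
  gain-max-∷-321 (c ∷ v) (c<m ∷ _) = cong indicator (<ᵇ-true c<m)

  -- Here the last two letters matter; for empty `v` they are `m` and `c`, a descent.
  gain-∷-123 : ∀ {c} u v → All (_< m) (c ∷ v) → gain p123 (u ++ m ∷ c ∷ v) ≡ gain p123 (c ∷ v)
  gain-∷-123 []          []      (c<m ∷ []) = cong indicator (<ᵇ-false (<⇒≤ c<m))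
  gain-∷-123 []          (_ ∷ _) _          = refl
  gain-∷-123 (_ ∷ [])    v       v<m        = gain-∷-123 [] v v<m
  gain-∷-123 (_ ∷ b ∷ []) v      v<m        = gain-∷-123 (b ∷ []) v v<m
  gain-∷-123 (_ ∷ b ∷ c ∷ u) v   v<m        = gain-∷-123 (b ∷ c ∷ u) v v<m

  gain-∷ʳ-max-123 : ∀ u → All (_< m) u → gain p123 (u ++ [ m ]) ≡ nonempty u
  gain-∷ʳ-max-123 []              _           = refl
  gain-∷ʳ-max-123 (a ∷ [])        (a<m ∷ [])  = cong indicator (<ᵇ-true a<m)
  gain-∷ʳ-max-123 (a ∷ b ∷ [])    (_ ∷ u<m)   = gain-∷ʳ-max-123 (b ∷ []) u<m
  gain-∷ʳ-max-123 (a ∷ b ∷ c ∷ u) (_ ∷ u<m)   = gain-∷ʳ-max-123 (b ∷ c ∷ u) u<m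

  glue-<ˡ : Avoiding p u → All (_< length u + length v) (map (length v +_) u)
  glue-<ˡ {u = u} {v} av-u = All.map⁺ (All.tabulate λ {a} a∈u →
    subst (length v + a <_) (+-comm (length v) (length u))
      (+-monoʳ-< (length v) (subst (a <_) (sym (Avoiding-length av-u)) (Avoiding-< av-u a∈u))))

  glue-<ʳ : Avoiding q v → All (_< length u + length v) v
  glue-<ʳ {v = v} {u} av-v = All.tabulate λ {c} c∈v →
    m≤n⇒m≤o+n (length u) (subst (c <_) (sym (Avoiding-length av-v)) (Avoiding-< av-v c∈v))

  module _ (av-u : Avoiding p u) (av-v : Avoiding q v) where
    private
      u⁺ = map (length v +_) u
      top = length u + length v
      u⁺<top = glue-<ˡ {v = v} av-u
      v<top = glue-<ʳ {u = u} av-v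

    open ≡-Reasoning

    occ-glue-321 : occ p321 (glue u v) ≡ occ p321 u + capped p321 v
    occ-glue-321 = begin
      occ p321 (u⁺ ++ top ∷ v)                       ≡⟨ occ-peak p321 u⁺ v u⁺<top v<top ⟩
      occ p321 (u⁺ ++ [ top ]) + occ p321 (top ∷ v)  ≡⟨ cong₂ _+_ (occ-∷ʳ-max-321 u⁺ u⁺<top) (occ-max-∷-321 v<top) ⟩
      occ p321 u⁺ + capped p321 v                    ≡⟨ cong (_+ capped p321 v) (occ-map-+ p321 (length v) u) ⟩
      occ p321 u + capped p321 v                     ∎

    occ-glue-123 : occ p123 (glue u v) ≡ capped p123 u + occ p123 v
    occ-glue-123 = begin
      occ p123 (u⁺ ++ top ∷ v)                       ≡⟨ occ-peak p123 u⁺ v u⁺<top v<top ⟩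
      occ p123 (u⁺ ++ [ top ]) + occ p123 (top ∷ v)  ≡⟨ cong₂ _+_ (occ-∷ʳ-max-123 u⁺ u⁺<top) (occ-max-∷-123 v<top) ⟩
      capped p123 u⁺ + occ p123 v                    ≡⟨ cong (_+ occ p123 v) (capped-map-+ p123 (length v) u) ⟩
      capped p123 u + occ p123 v                     ∎

  -- The added letter in front meets only the beginning of the nonempty left part, while the largest
  -- letter of the glued word acts as the cap of `v`; the two contributions add up.
  capped-glue-321-∷ : ∀ {a} → Avoiding p (a ∷ u) → Avoiding q v →
                      capped p321 (glue (a ∷ u) v) ≡ capped p321 (a ∷ u) + capped p321 v
  capped-glue-321-∷ {u = u} {v = v} {a} av-u av-v = trans
    (cong₂ _+_ (occ-glue-321 av-u av-v)
      (trans (gain-∷-321 (map (length v +_) u) v (glue-<ˡ {v = v} av-u)) (gain-map-+ p321 (length v) (a ∷ u))))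
    (xy∙z≈xz∙y (occ p321 (a ∷ u)) _ _)

  capped-glue-321-[] : Avoiding q v → capped p321 (glue [] v) ≡ nonempty v + capped p321 v
  capped-glue-321-[] {v = v} av-v = trans
    (cong₂ _+_ (occ-max-∷-321 (glue-<ʳ {u = []} av-v)) (gain-max-∷-321 v (glue-<ʳ {u = []} av-v)))
    (+-comm (capped p321 v) (nonempty v))

  capped-glue-123-∷ : ∀ {c} → Avoiding p u → Avoiding q (c ∷ v) →
                      capped p123 (glue u (c ∷ v)) ≡ capped p123 (c ∷ v) + capped p123 u
  capped-glue-123-∷ {u = u} {v = v} {c} av-u av-v = trans
    (cong₂ _+_ (occ-glue-123 av-u av-v)
      (gain-∷-123 (map (suc (length v) +_) u) v (glue-<ʳ {u = u} av-v)))
    (trans (+-assoc (capped p123 u) _ _) (+-comm (capped p123 u) _))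

  capped-glue-123-[] : Avoiding p u → capped p123 (glue u []) ≡ nonempty u + capped p123 u
  capped-glue-123-[] {u = u} av-u = trans
    (cong₂ _+_ (trans (occ-glue-123 av-u (↭-refl , λ ())) (+-identityʳ _))
      (trans (gain-∷ʳ-max-123 (map (0 +_) u) (glue-<ˡ {v = []} av-u)) (nonempty-map-+ 0 u)))
    (+-comm (capped p123 u) (nonempty u))

  -- Passage from one-line notation to lists.

  word : Vec (Fin n) m → List ℕ
  word []      = []
  word (x ∷ π) = toℕ x ∷ word π

  length-word : (π : Vec (Fin n) m) → length (word π) ≡ m
  length-word []      = refl
  length-word (_ ∷ π) = cong suc (length-word π)

  word-< : (π : Vec (Fin n) m) → x ∈ word π → x < n
  word-< (i ∷ π) (here refl) = Fin.toℕ<n i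
  word-< (_ ∷ π) (there x∈π) = word-< π x∈π

  word-injective : {π ρ : Vec (Fin n) m} → word π ≡ word ρ → π ≡ ρ
  word-injective {π = []}    {[]}    _  = refl
  word-injective {π = _ ∷ _} {_ ∷ _} eq with i≡j , eq′ ← List.∷-injective eq =
    cong₂ _∷_ (Fin.toℕ-injective i≡j) (word-injective eq′)

  word-surjective : ∀ m w → length w ≡ m → All (_< n) w → ∃ λ (π : Vec (Fin n) m) → word π ≡ w
  word-surjective zero    []      _     []          = [] , refl
  word-surjective (suc m) (x ∷ w) |w|≡m (x<n ∷ w<n) with word-surjective m w (suc-injective |w|≡m) w<n
  ... | π , refl = fromℕ< x<n ∷ π , cong (_∷ word π) (Fin.toℕ-fromℕ< x<n)

  Unique-word⁺ : {π : Vec (Fin n) m} → Vec.Unique π → Unique (word π)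
  Unique-word⁺ []          = []
  Unique-word⁺ (i∉π ∷ π!)  = all i∉π ∷ Unique-word⁺ π!
    where
    all : ∀ {m i} {π : Vec (Fin n) m} → VecAll.All (i ≢_) π → All (toℕ i ≢_) (word π)
    all []            = []
    all (i≢j ∷ i∉π)   = (i≢j ∘ Fin.toℕ-injective) ∷ all i∉π

  Unique-word⁻ : (π : Vec (Fin n) m) → Unique (word π) → Vec.Unique π
  Unique-word⁻ []      []           = []
  Unique-word⁻ (i ∷ π) (i∉π ∷ π!)   = all π i∉π ∷ Unique-word⁻ π π!
    where
    all : ∀ {m i} (π : Vec (Fin n) m) → All (toℕ i ≢_) (word π) → VecAll.All (i ≢_) π
    all []      []          = []
    all (j ∷ π) (i≢j ∷ i∉π) = (i≢j ∘ cong toℕ) ∷ all π i∉π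

  ⊆-word¹ : (π : Vec (Fin n) m) → x ∷ [] ⊆ word π → ∃ λ i → toℕ (lookup π i) ≡ x
  ⊆-word¹ (_ ∷ π) (_ ∷ʳ x⊆)  with i , eq ← ⊆-word¹ π x⊆ = Fin.suc i , eq
  ⊆-word¹ (_ ∷ π) (refl ∷ _) = Fin.zero , refl

  ⊆-word² : ∀ {a b} (π : Vec (Fin n) m) → a ∷ b ∷ [] ⊆ word π →
            ∃₂ λ i j → i Fin.< j × toℕ (lookup π i) ≡ a × toℕ (lookup π j) ≡ b
  ⊆-word² (_ ∷ π) (_ ∷ʳ ab⊆)  with i , j , i<j , eqs ← ⊆-word² π ab⊆ = Fin.suc i , Fin.suc j , s≤s i<j , eqs
  ⊆-word² (_ ∷ π) (refl ∷ b⊆) with j , eq ← ⊆-word¹ π b⊆ = Fin.zero , Fin.suc j , s≤s z≤n , refl , eq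

  Avoids-word⁺ : (π : Vec (Fin n) m) → Avoids132 π → Avoids (word π)
  Avoids-word⁺ (_ ∷ π) avoids (_ ∷ʳ abc⊆) =
    Avoids-word⁺ π (λ i j k i<j j<k → avoids (Fin.suc i) (Fin.suc j) (Fin.suc k) (s≤s i<j) (s≤s j<k)) abc⊆
  Avoids-word⁺ (_ ∷ π) avoids (refl ∷ bc⊆) a<c c<b with j , k , j<k , refl , refl ← ⊆-word² π bc⊆ =
    avoids Fin.zero (Fin.suc j) (Fin.suc k) (s≤s z≤n) (s≤s j<k) (a<c , c<b)

  word-⊇¹ : (π : Vec (Fin n) m) → ∀ i → toℕ (lookup π i) ∷ [] ⊆ word π
  word-⊇¹ (_ ∷ π) Fin.zero    = refl ∷ minimum (word π)
  word-⊇¹ (x ∷ π) (Fin.suc i) = toℕ x ∷ʳ word-⊇¹ π i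

  word-⊇² : (π : Vec (Fin n) m) → ∀ i j → i Fin.< j → toℕ (lookup π i) ∷ toℕ (lookup π j) ∷ [] ⊆ word π
  word-⊇² (_ ∷ π) Fin.zero    (Fin.suc j) _         = refl ∷ word-⊇¹ π j
  word-⊇² (x ∷ π) (Fin.suc i) (Fin.suc j) (s≤s i<j) = toℕ x ∷ʳ word-⊇² π i j i<j

  word-⊇³ : (π : Vec (Fin n) m) → ∀ i j k → i Fin.< j → j Fin.< k →
            toℕ (lookup π i) ∷ toℕ (lookup π j) ∷ toℕ (lookup π k) ∷ [] ⊆ word π
  word-⊇³ (_ ∷ π) Fin.zero    (Fin.suc j) (Fin.suc k) _         (s≤s j<k) = refl ∷ word-⊇² π j k j<k
  word-⊇³ (x ∷ π) (Fin.suc i) (Fin.suc j) (Fin.suc k) (s≤s i<j) (s≤s j<k) = toℕ x ∷ʳ word-⊇³ π i j k i<j j<k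

  Avoids-word⁻ : (π : Vec (Fin n) m) → Avoids (word π) → Avoids132 π
  Avoids-word⁻ π avoids i j k i<j j<k (a<c , c<b) = avoids (word-⊇³ π i j k i<j j<k) a<c c<b

  length-filter-∷ : ∀ {P : A → Set} (P? : Decidable P) x xs →
                    length (filter P? (x ∷ xs)) ≡ indicator (does (P? x)) + length (filter P? xs)
  length-filter-∷ P? x xs with does (P? x)
  ... | true  = refl
  ... | false = refl

  does-matches? : ∀ τ (a b c : Fin n) → does (matches? τ (a , b , c)) ≡ matches τ (toℕ a) (toℕ b) (toℕ c)
  does-matches? p123 a b c = refl
  does-matches? p321 a b c = refl

  occurrences-word : ∀ τ (π : Vec (Fin n) m) → occurrences τ π ≡ occ τ (word π)
  occurrences-word τ []              = refl
  occurrences-word τ (_ ∷ [])        = refl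
  occurrences-word τ (_ ∷ _ ∷ [])    = refl
  occurrences-word τ (a ∷ b ∷ c ∷ π) = trans
    (length-filter-∷ (matches? τ) (a , b , c) (consecutiveTriples (b ∷ c ∷ π)))
    (cong₂ _+_ (cong indicator (does-matches? τ a b c)) (occurrences-word τ (b ∷ c ∷ π)))

  ∈-words : (π : Vec (Fin n) m) → π ∈ words n m
  ∈-words []      = here refl
  ∈-words (i ∷ π) = ∈-cartesianProductWith⁺ _∷_ (∈-allFin i) (∈-words π)

  words-unique : ∀ n m → Unique (words n m)
  words-unique n zero    = [] ∷ []
  words-unique n (suc m) =
    Unique.cartesianProductWith⁺ _∷_ Vec.∷-injective (Unique.allFin⁺ n) (words-unique n m)

  -- Enumeration of the avoiders and of pairs of avoiders.

  Unique⇒length≤ : {xs ys : List A} → Unique xs → (∀ {x} → x ∈ xs → x ∈ ys) → length xs ≤ length ys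
  Unique⇒length≤ {xs = []}     _          _     = z≤n
  Unique⇒length≤ {xs = x ∷ xs} (x∉xs ∷ xs!) xs⊆ys with ∈-∃++ (xs⊆ys (here refl))
  ... | ys₁ , ys₂ , refl = ≤-trans (s≤s (Unique⇒length≤ xs! xs⊆))
    (≤-reflexive (trans (cong suc (List.length-++ ys₁)) (sym (trans (List.length-++ ys₁) (+-suc _ _)))))
    where
    xs⊆ : ∀ {z} → z ∈ xs → z ∈ ys₁ ++ ys₂
    xs⊆ z∈xs with ∈-++⁻ ys₁ (xs⊆ys (there z∈xs))
    ... | inj₁ z∈ys₁         = ∈-++⁺ˡ z∈ys₁
    ... | inj₂ (here refl)   = contradiction refl (All.lookup x∉xs z∈xs)
    ... | inj₂ (there z∈ys₂) = ∈-++⁺ʳ ys₁ z∈ys₂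

  unique-set⇒↭ : {xs ys : List A} → Unique xs → Unique ys →
                 (∀ {x} → x ∈ xs → x ∈ ys) → (∀ {x} → x ∈ ys → x ∈ xs) → xs ↭ ys
  unique-set⇒↭ xs! ys! xs⊆ys ys⊆xs = ∼bag⇒↭ (unique∧set⇒bag xs! ys! (mk⇔ xs⊆ys ys⊆xs))

  unique⇒↭interval : Unique w → (∀ {x} → x ∈ w → x < n) → length w ≡ n → w ↭ interval 0 n
  unique⇒↭interval {w} {n} w! w<n |w|≡n =
    unique-set⇒↭ w! (interval-unique 0 n) w⊆ ⊆w
    where
    open import Data.List.Membership.DecPropositional _≟_ using (_∈?_)
    w⊆ : ∀ {x} → x ∈ w → x ∈ interval 0 n
    w⊆ x∈w = ∈-interval⁺ n z≤n (w<n x∈w)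
    ⊆w : ∀ {x} → x ∈ interval 0 n → x ∈ w
    ⊆w {x} x∈ with x ∈? w
    ... | yes x∈w = x∈w
    -- Pigeonhole: `x ∷ w` would consist of n + 1 distinct letters from an interval of length n.
    ... | no  x∉w = contradiction
      (Unique⇒length≤ (All.tabulate (λ { z∈w refl → x∉w z∈w }) ∷ w!) λ { (here refl) → x∈ ; (there z∈w) → w⊆ z∈w })
      (<⇒≱ (s≤s (≤-reflexive (trans (length-interval 0 n) (sym |w|≡n)))))

  Permutation132 : Vec (Fin n) n → Set
  Permutation132 π = Vec.Unique π × Avoids132 π

  permutation132? : Decidable (Permutation132 {n})
  permutation132? π = allPairs? (λ a b → ¬? (a Fin.≟ b)) π ×-dec avoids132? π

  -- One list for both patterns and all r: the statistics become weights on it, and the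
  -- decomposition is needed only once.
  avoiders : ℕ → List (List ℕ)
  avoiders n = map word (filter permutation132? (words n n))

  avoiders-unique : ∀ n → Unique (avoiders n)
  avoiders-unique n = Unique.map⁺ word-injective (Unique.filter⁺ permutation132? (words-unique n n))

  ∈-avoiders⁻ : ∀ n → w ∈ avoiders n → Avoiding n w
  ∈-avoiders⁻ n w∈ with π , π∈ , refl ← ∈-map⁻ word w∈
    with _ , π! , avoids ← ∈-filter⁻ permutation132? {xs = words n n} π∈ =
    unique⇒↭interval (Unique-word⁺ π!) (word-< π) (length-word π) , Avoids-word⁺ π avoids

  ∈-avoiders⁺ : ∀ n → Avoiding n w → w ∈ avoiders n
  ∈-avoiders⁺ {w} n av@(w↭ , avoids) with word-surjective n w (Avoiding-length av) (All.tabulate (Avoiding-< av))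
  ... | π , refl = ∈-map⁺ word (∈-filter⁺ permutation132? (∈-words π)
    ( Unique-word⁻ π (SetoidPerm.Unique-resp-↭ (setoid ℕ) (↭⇒↭ₛ (↭-sym w↭)) (interval-unique 0 n))
    , Avoids-word⁻ π avoids ))

  -- Separates the conditions defining `f`: being an avoider selects the list, and the number of
  -- occurrences is tested afterwards on the translated words.
  length-filter-map : ∀ {P : A → Set} {Q : B → Set} {R : A → Set}
    (P? : Decidable P) (Q? : Decidable Q) (R? : Decidable R) (g : A → B) →
    (∀ {x} → R x → P x × Q (g x)) → (∀ {x} → P x → Q (g x) → R x) → ∀ xs →
    length (filter R? xs) ≡ length (filter Q? (map g (filter P? xs)))
  length-filter-map P? Q? R? g split join []       = refl
  length-filter-map P? Q? R? g split join (x ∷ xs) with R? x | P? x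
  ... | no _  | no _  = length-filter-map P? Q? R? g split join xs
  ... | yes r | no ¬p = contradiction (proj₁ (split r)) ¬p
  ... | no ¬r | yes p = trans (length-filter-map P? Q? R? g split join xs)
    (sym (cong length (List.filter-reject Q? (λ q → ¬r (join p q)))))
  ... | yes r | yes p = trans (cong suc (length-filter-map P? Q? R? g split join xs))
    (sym (cong length (List.filter-accept Q? (proj₂ (split r)))))

  f≡count : ∀ τ r n → f τ r n ≡ length (filter (λ w → occ τ w ≟ r) (avoiders n))
  f≡count τ r n = length-filter-map permutation132? (λ w → occ τ w ≟ r) (counted? τ r) word
    (λ { {π} (π! , avoids , occ≡r) → (π! , avoids) , trans (sym (occurrences-word τ π)) occ≡r })
    (λ { {π} (π! , avoids) occ≡r → π! , avoids , trans (occurrences-word τ π) occ≡r })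
    (words n n)

  -- Indexed exactly like the summands of coefficient `n` in a product of power series.
  avoiderPairsAt : ∀ n → Fin (suc n) → List (List ℕ × List ℕ)
  avoiderPairsAt n i = cartesianProduct (avoiders (toℕ i)) (avoiders (n ∸ toℕ i))

  avoiderPairs : ℕ → List (List ℕ × List ℕ)
  avoiderPairs n = concat (tabulate (avoiderPairsAt n))

  ∈-avoiderPairs⁺ : ∀ {u v} n → Avoiding (length u) u → Avoiding (length v) v → length u + length v ≡ n →
                    (u , v) ∈ avoiderPairs n
  ∈-avoiderPairs⁺ {u} {v} n av-u av-v refl = ∈-concat⁺′
    (∈-cartesianProduct⁺ (subst (λ j → u ∈ avoiders j) (sym i≡) (∈-avoiders⁺ (length u) av-u))
      (subst (λ j → v ∈ avoiders j) (sym (trans (cong (n ∸_) i≡) (m+n∸m≡n (length u) (length v))))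
        (∈-avoiders⁺ (length v) av-v)))
    (∈-tabulate⁺ {f = avoiderPairsAt (length u + length v)} i)
    where
    i : Fin (suc (length u + length v))
    i = fromℕ< (s≤s (m≤m+n (length u) (length v)))
    i≡ : toℕ i ≡ length u
    i≡ = Fin.toℕ-fromℕ< _

  ∈-avoiderPairs⁻ : ∀ {u v} n → (u , v) ∈ avoiderPairs n → ∃ λ i → i ≤ n × Avoiding i u × Avoiding (n ∸ i) v
  ∈-avoiderPairs⁻ n uv∈ with ∈-concat⁻′ _ uv∈
  ... | _ , uv∈xs , xs∈ with i , refl ← ∈-tabulate⁻ {f = avoiderPairsAt n} xs∈
    with u∈ , v∈ ← ∈-cartesianProduct⁻ (avoiders (toℕ i)) (avoiders (n ∸ toℕ i)) uv∈xs =
    toℕ i , Fin.toℕ≤pred[n] i , ∈-avoiders⁻ (toℕ i) u∈ , ∈-avoiders⁻ (n ∸ toℕ i) v∈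

  -- Blocks with different indices are disjoint, since the index is the length of the first
  -- component.
  avoiderPairs-unique : ∀ n → Unique (avoiderPairs n)
  avoiderPairs-unique n = Unique.concat⁺
    (All.tabulate⁺ λ i → Unique.cartesianProduct⁺ (avoiders-unique (toℕ i)) (avoiders-unique (n ∸ toℕ i)))
    (AllPairs.tabulate⁺ λ {i} {j} i≢j (uv∈i , uv∈j) → i≢j (Fin.toℕ-injective
      (trans (sym (length-fst i uv∈i)) (length-fst j uv∈j))))
    where
    length-fst : ∀ {u v} (i : Fin (suc n)) →
                 (u , v) ∈ avoiderPairsAt n i → length u ≡ toℕ i
    length-fst i uv∈ = Avoiding-length (∈-avoiders⁻ (toℕ i)
      (proj₁ (∈-cartesianProduct⁻ (avoiders (toℕ i)) (avoiders (n ∸ toℕ i)) uv∈)))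

  Unique-map : (g : A → B) {xs : List A} → (∀ {x y} → x ∈ xs → y ∈ xs → g x ≡ g y → x ≡ y) →
               Unique xs → Unique (map g xs)
  Unique-map g inj []           = []
  Unique-map g inj (x∉xs ∷ xs!) =
    All.map⁺ (All.tabulate λ y∈xs gx≡gy → All.lookup x∉xs y∈xs (inj (here refl) (there y∈xs) gx≡gy))
    ∷ Unique-map g (λ x∈ y∈ → inj (there x∈) (there y∈)) xs!

  -- The bijection behind the recurrences: `unglue` and `glue-avoiding` give the two inclusions,
  -- `glue-injective` excludes repetitions. A rearrangement is enough, as sums do not see the order.
  avoiders-suc : ∀ n → avoiders (suc n) ↭ map (uncurry glue) (avoiderPairs n)
  avoiders-suc n = unique-set⇒↭ (avoiders-unique (suc n))
    (Unique-map (uncurry glue) injective (avoiderPairs-unique n)) split join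
    where
    injective : ∀ {x y} → x ∈ avoiderPairs n → y ∈ avoiderPairs n → uncurry glue x ≡ uncurry glue y → x ≡ y
    injective x∈ y∈ eq with ∈-avoiderPairs⁻ n x∈ | ∈-avoiderPairs⁻ n y∈
    ... | _ , _ , av-u , _ | _ , _ , av-u′ , _ with refl , refl ← glue-injective av-u av-u′ eq = refl
    split : ∀ {w} → w ∈ avoiders (suc n) → w ∈ map (uncurry glue) (avoiderPairs n)
    split w∈ with u , v , av-u , av-v , |u|+|v|≡n , refl ← unglue (∈-avoiders⁻ (suc n) w∈) =
      ∈-map⁺ (uncurry glue) (∈-avoiderPairs⁺ n av-u av-v |u|+|v|≡n)
    join : ∀ {w} → w ∈ map (uncurry glue) (avoiderPairs n) → w ∈ avoiders (suc n)
    join w∈ with _ , uv∈ , refl ← ∈-map⁻ (uncurry glue) w∈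
      with i , i≤n , av-u , av-v ← ∈-avoiderPairs⁻ n uv∈ =
      ∈-avoiders⁺ (suc n) (subst (λ j → Avoiding (suc j) _) (m+[n∸m]≡n i≤n) (glue-avoiding av-u av-v))

open Words

-- Recurrences for sums over avoiders, uniformly in the pattern.

private variable
  A B : Set

-- In glue u v the largest letter caps exactly one of u and v; order puts that
-- one second.
order : Pattern → List ℕ × List ℕ → List ℕ × List ℕ
order p321 (u , v) = u , v
order p123 (u , v) = v , u

occ-glue : ∀ τ {p q u v} → Avoiding p u → Avoiding q v → let (s , t) = order τ (u , v) in
           occ τ (glue u v) ≡ occ τ s ℕ.+ capped τ t
occ-glue p321 av-u av-v = occ-glue-321 av-u av-v
occ-glue p123 {v = v} av-u av-v = ≡.trans (occ-glue-123 av-u av-v) (ℕ.+-comm _ (occ p123 v))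

capped-[] : ∀ τ → capped τ [] ≡ 0
capped-[] p123 = ≡.refl
capped-[] p321 = ≡.refl

module GeneratingFunction {ℓ : Level} (K : CommutativeRing 0ℓ ℓ) (y : CommutativeRing.Carrier K) where
  private module K = CommutativeRing K
  open K
  open PowerSeries K
  open Sum +-commutativeMonoid using (sum; sum-cong-≋)
  open Exp semiring using (_^_; ^-homo-*)
  open CommutativeSemigroupProperties +-commutativeSemigroup using (interchange; x∙yz≈y∙xz)
  open AbelianGroupProperties +-abelianGroup using (⁻¹-∙-comm)
  open RingProperties ring using (-0#≈0#)
  open IntegerCoefficients K
  open SetoidReasoning setoid

  Σ[_] : (A → Carrier) → List A → Carrier
  Σ[ g ] []       = 0#
  Σ[ g ] (x ∷ xs) = g x + Σ[ g ] xs

  Σ-cong : ∀ {g h : A → Carrier} xs → (∀ {x} → x ∈ xs → g x ≈ h x) → Σ[ g ] xs ≈ Σ[ h ] xs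
  Σ-cong []       g≈h = K.refl
  Σ-cong (x ∷ xs) g≈h = +-cong (g≈h (here ≡.refl)) (Σ-cong xs (g≈h ∘ there))

  Σ-↭ : ∀ (g : A → Carrier) {xs ys} → xs ↭ ys → Σ[ g ] xs ≈ Σ[ g ] ys
  Σ-↭ g _↭_.refl          = K.refl
  Σ-↭ g (_↭_.prep x p)    = +-congˡ (Σ-↭ g p)
  Σ-↭ g (_↭_.swap x z p)  = K.trans (x∙yz≈y∙xz _ _ _) (+-congˡ (+-congˡ (Σ-↭ g p)))
  Σ-↭ g (_↭_.trans p q)   = K.trans (Σ-↭ g p) (Σ-↭ g q)

  Σ-++ : ∀ (g : A → Carrier) xs ys → Σ[ g ] (xs ++ ys) ≈ Σ[ g ] xs + Σ[ g ] ys
  Σ-++ g []       ys = sym (+-identityˡ _)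
  Σ-++ g (x ∷ xs) ys = K.trans (+-congˡ (Σ-++ g xs ys)) (sym (+-assoc _ _ _))

  Σ-concat-tabulate : ∀ (g : A → Carrier) {n} (xss : Fin n → List A) →
                      Σ[ g ] (concat (tabulate xss)) ≈ sum (λ i → Σ[ g ] (xss i))
  Σ-concat-tabulate g {zero}  xss = K.refl
  Σ-concat-tabulate g {suc n} xss = K.trans (Σ-++ g (xss Fin.zero) _)
    (+-congˡ (Σ-concat-tabulate g (xss ∘ Fin.suc)))

  Σ-map : ∀ (g : B → Carrier) (h : A → B) xs → Σ[ g ] (map h xs) ≡ Σ[ g ∘ h ] xs
  Σ-map g h []       = ≡.refl
  Σ-map g h (x ∷ xs) = ≡.cong (g (h x) +_) (Σ-map g h xs)

  Σ-+ : ∀ (g h : A → Carrier) xs → Σ[ (λ x → g x + h x) ] xs ≈ Σ[ g ] xs + Σ[ h ] xs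
  Σ-+ g h []       = sym (+-identityˡ _)
  Σ-+ g h (x ∷ xs) = K.trans (+-congˡ (Σ-+ g h xs)) (interchange _ _ _ _)

  Σ-* : ∀ k (g : A → Carrier) xs → Σ[ (λ x → k * g x) ] xs ≈ k * Σ[ g ] xs
  Σ-* k g []       = sym (zeroʳ k)
  Σ-* k g (x ∷ xs) = K.trans (+-congˡ (Σ-* k g xs)) (sym (distribˡ _ _ _))

  Σ-neg : ∀ (g : A → Carrier) xs → Σ[ (λ x → - g x) ] xs ≈ - Σ[ g ] xs
  Σ-neg g []       = sym -0#≈0#
  Σ-neg g (x ∷ xs) = K.trans (+-congˡ (Σ-neg g xs)) (⁻¹-∙-comm _ _)

  Σ-cartesianProduct : ∀ (g : A → Carrier) (h : B → Carrier) xs ys →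
    Σ[ (λ (x , z) → g x * h z) ] (cartesianProduct xs ys) ≈ Σ[ g ] xs * Σ[ h ] ys
  Σ-cartesianProduct g h []       ys = sym (zeroˡ _)
  Σ-cartesianProduct g h (x ∷ xs) ys = begin
    Σ[ gh ] (map (x ,_) ys ++ cartesianProduct xs ys)              ≈⟨ Σ-++ gh (map (x ,_) ys) _ ⟩
    Σ[ gh ] (map (x ,_) ys) + Σ[ gh ] (cartesianProduct xs ys)
      ≈⟨ +-cong (K.trans (reflexive (Σ-map gh (x ,_) ys)) (Σ-* (g x) h ys)) (Σ-cartesianProduct g h xs ys) ⟩
    g x * Σ[ h ] ys + Σ[ g ] xs * Σ[ h ] ys                        ≈⟨ distribʳ _ _ _ ⟨
    Σ[ g ] (x ∷ xs) * Σ[ h ] ys                                    ∎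
    where gh = λ (x , z) → g x * h z

  gf : (List ℕ → Carrier) → Seq
  gf g n = Σ[ g ] (avoiders n)

  -- For `p123` the roles of the two components are exchanged; commutativity of the product, first
  -- of weights and then of series, undoes this. From here on both patterns obey the same
  -- recurrences.
  Σ-avoiderPairs : ∀ τ (g h : List ℕ → Carrier) n →
    Σ[ (λ uv → let (s , t) = order τ uv in g s * h t) ] (avoiderPairs n) ≈ (gf g *ˢ gf h) n
  Σ-avoiderPairs p321 g h n = K.trans (Σ-concat-tabulate _ (avoiderPairsAt n))
    (sum-cong-≋ {suc n} λ i → Σ-cartesianProduct g h (avoiders (toℕ i)) (avoiders (n ∸ toℕ i)))
  Σ-avoiderPairs p123 g h n = begin
    Σ[ (λ (u , v) → g v * h u) ] (avoiderPairs n)   ≈⟨ Σ-cong (avoiderPairs n) (λ _ → *-comm _ _) ⟩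
    Σ[ (λ (u , v) → h u * g v) ] (avoiderPairs n)   ≈⟨ Σ-avoiderPairs p321 h g n ⟩
    (gf h *ˢ gf g) n                                ≈⟨ *ˢ-comm (gf h) (gf g) n ⟩
    (gf g *ˢ gf h) n                                ∎

  gf-suc : ∀ (g : List ℕ → Carrier) (h : List ℕ × List ℕ → Carrier) n →
           (∀ {p q u v} → Avoiding p u → Avoiding q v → g (glue u v) ≈ h (u , v)) →
           gf g (suc n) ≈ Σ[ h ] (avoiderPairs n)
  gf-suc g h n g≈h = begin
    Σ[ g ] (avoiders (suc n))                      ≈⟨ Σ-↭ g (avoiders-suc n) ⟩
    Σ[ g ] (map (uncurry glue) (avoiderPairs n))   ≡⟨ Σ-map g (uncurry glue) (avoiderPairs n) ⟩
    Σ[ g ∘ uncurry glue ] (avoiderPairs n)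
      ≈⟨ Σ-cong (avoiderPairs n) (λ uv∈ → let (_ , _ , av-u , av-v) = ∈-avoiderPairs⁻ n uv∈ in g≈h av-u av-v) ⟩
    Σ[ h ] (avoiderPairs n)                        ∎

  -- A weight whose series is 1, which allows a sum restricted to an empty component to be treated
  -- as a product of two series.
  empty : List ℕ → Carrier
  empty []      = 1#
  empty (_ ∷ _) = 0#

  gf-empty : gf empty ≈ˢ 1ˢ
  gf-empty zero    = +-identityʳ 1#
  gf-empty (suc n) = K.trans (Σ-cong {h = λ _ → 0#} (avoiders (suc n)) (λ w∈ → vanish (∈-avoiders⁻ (suc n) w∈)))
    -- The sum of zeros is rewritten as `0#` times a sum.
    (K.trans (Σ-cong (avoiders (suc n)) (λ _ → sym (zeroʳ 0#))) (K.trans (Σ-* 0# (λ _ → 0#) (avoiders (suc n))) (zeroˡ _)))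
    where
    vanish : ∀ {w} → Avoiding (suc n) w → empty w ≈ 0#
    vanish {[]}    av with () ← Avoiding-length av
    vanish {_ ∷ _} _  = K.refl

  module _ (τ : Pattern) where
    Occ Cap : Seq
    Occ = gf λ w → y ^ occ τ w
    Cap = gf λ w → y ^ capped τ w

    -- The change in weight caused by one additional occurrence: y^(c+1) - y^c for nonempty `w` with
    -- capped count c, and 0 for the empty word.
    excess : List ℕ → Carrier
    excess w = (y - 1#) * (y ^ capped τ w - empty w)

    gf-excess : ∀ n → gf excess n ≈ (y - 1#) * (Cap n - 1ˢ n)
    gf-excess n = K.trans (Σ-* (y - 1#) _ (avoiders n)) (*-congˡ (K.trans (Σ-+ _ _ (avoiders n))
      (+-congˡ (K.trans (Σ-neg empty (avoiders n)) (-‿cong (gf-empty n))))))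

    Occ-suc : ∀ n → Occ (suc n) ≈ (Occ *ˢ Cap) n
    Occ-suc n = K.trans
      (gf-suc _ _ n λ {_} {_} {u} {v} av-u av-v → let (s , t) = order τ (u , v) in
        K.trans (reflexive (≡.cong (y ^_) (occ-glue τ av-u av-v))) (^-homo-* y (occ τ s) (capped τ t)))
      (Σ-avoiderPairs τ _ _ n)

    -- The correction is for empty s: then the cap, the largest letter and its
    -- neighbour in t, if there is one, form an additional occurrence.
    append : List ℕ → List ℕ → Carrier
    append s t = y ^ capped τ s * y ^ capped τ t + empty s * excess t

    ^-append-∷ : ∀ {k} a s t → k ≡ capped τ (a ∷ s) ℕ.+ capped τ t → y ^ k ≈ append (a ∷ s) t
    ^-append-∷ a s t ≡.refl = K.trans (^-homo-* y (capped τ (a ∷ s)) (capped τ t))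
      (sym (K.trans (+-congˡ (zeroˡ _)) (+-identityʳ _)))

    ^-append-[] : ∀ {k} t → k ≡ nonempty t ℕ.+ capped τ t → y ^ k ≈ append [] t
    ^-append-[] []      ≡.refl rewrite capped-[] τ =
      solve 1 (λ y → let one = con ℤ.1ℤ in
        one := one :* one :+ one :* ((y :- one) :* (one :- one))) K.refl y
    ^-append-[] (b ∷ t) ≡.refl rewrite capped-[] τ =
      solve 2 (λ y z → let one = con ℤ.1ℤ in
        y :* z := one :* z :+ one :* ((y :- one) :* (z :- con ℤ.0ℤ))) K.refl y (y ^ capped τ (b ∷ t))

  ^-capped-glue : ∀ τ {p q u v} → Avoiding p u → Avoiding q v →
                  y ^ capped τ (glue u v) ≈ uncurry (append τ) (order τ (u , v))
  ^-capped-glue p321 {u = []}    {v}     _    av-v = ^-append-[] p321 v (capped-glue-321-[] av-v)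
  ^-capped-glue p321 {u = a ∷ u} {v}     av-u av-v = ^-append-∷ p321 a u v (capped-glue-321-∷ av-u av-v)
  ^-capped-glue p123 {u = u}     {[]}    av-u _    = ^-append-[] p123 u (capped-glue-123-[] av-u)
  ^-capped-glue p123 {u = u}     {c ∷ v} av-u av-v = ^-append-∷ p123 c v u (capped-glue-123-∷ av-u av-v)

  Cap-zero : ∀ τ → Cap τ 0 ≈ 1#
  Cap-zero τ rewrite capped-[] τ = +-identityʳ 1#

  Cap-suc : ∀ τ n → Cap τ (suc n) ≈ (Cap τ *ˢ Cap τ) n + (y - 1#) * (Cap τ n - 1ˢ n)
  Cap-suc τ n = begin
    Cap τ (suc n)
      ≈⟨ gf-suc _ _ n (^-capped-glue τ) ⟩
    Σ[ (λ uv → uncurry (append τ) (order τ uv)) ] (avoiderPairs n)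
      ≈⟨ Σ-+ _ _ (avoiderPairs n) ⟩
    -- The correction is a product with left factor `gf empty`, the series 1, and so collapses to
    -- coefficient `n` of `gf (excess τ)`.
    _ ≈⟨ +-cong (Σ-avoiderPairs τ _ _ n) (Σ-avoiderPairs τ empty (excess τ) n) ⟩
    (Cap τ *ˢ Cap τ) n + (gf empty *ˢ gf (excess τ)) n
      ≈⟨ +-congˡ (*ˢ-cong {b = gf (excess τ)} gf-empty (λ _ → K.refl) n) ⟩
    (Cap τ *ˢ Cap τ) n + (1ˢ *ˢ gf (excess τ)) n
      ≈⟨ +-congˡ (K.trans (*ˢ-identityˡ (gf (excess τ)) n) (gf-excess τ n)) ⟩
    (Cap τ *ˢ Cap τ) n + (y - 1#) * (Cap τ n - 1ˢ n) ∎

-- Functional equations and the closed form.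

module Equations {ℓ : Level} (K : CommutativeRing 0ℓ ℓ) (y : CommutativeRing.Carrier K)
  (X : PowerSeries.Seq K) (X-isVariable : PowerSeries.IsVariable K X)
  (Y : PowerSeries.Seq K) (Y-isConstant : PowerSeries.IsConstant K y Y)
  where
  private module K = CommutativeRing K
  open K using () renaming (_≈_ to _≈ᴷ_; 0# to 0ᴷ; 1# to 1ᴷ)
  open PowerSeries K
  open GeneratingFunction K y
  open Shift X X-isVariable
  open CommutativeRing commutativeRing
  open Quadratic commutativeRing
  open AbelianGroupProperties +-abelianGroup using (x∙y⁻¹≈ε⇒x≈y)
  open RawSemiringDefinitions (RawRing.rawSemiring rawRing) using (_^_) renaming (_×_ to _·_)

  Occ-equation : ∀ τ → Occ τ ≈ 1# + X * (Occ τ * Cap τ)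
  Occ-equation τ zero    = K.trans (K.+-identityʳ 1ᴷ)
    (K.sym (K.trans (K.+-congˡ (shift-zero (Occ τ * Cap τ))) (K.+-identityʳ 1ᴷ)))
  Occ-equation τ (suc n) = K.trans (Occ-suc τ n)
    (K.sym (K.trans (K.+-identityˡ _) (shift-suc (Occ τ * Cap τ) n)))

  Y-1-isConstant : IsConstant (y K.- 1ᴷ) (Y - 1#)
  Y-1-isConstant = record
    { a₀≈k = K.+-congʳ (IsConstant.a₀≈k Y-isConstant)
    ; aₙ≈0 = λ n → K.trans (K.+-cong (IsConstant.aₙ≈0 Y-isConstant n) -0#≈0#) (K.+-identityʳ 0ᴷ)
    }
    where open RingProperties K.ring using (-0#≈0#)

  Cap-equation : ∀ τ → Cap τ ≈ 1# + X * (Cap τ * Cap τ + (Y - 1#) * (Cap τ - 1#))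
  Cap-equation τ zero    = K.trans (Cap-zero τ)
    (K.sym (K.trans (K.+-congˡ (shift-zero (Cap τ * Cap τ + (Y - 1#) * (Cap τ - 1#)))) (K.+-identityʳ 1ᴷ)))
  Cap-equation τ (suc n) = K.trans (Cap-suc τ n) (K.trans (K.+-congˡ (K.sym (constant-*ˢ Y-1-isConstant (Cap τ - 1#) n)))
    (K.sym (K.trans (K.+-identityˡ _) (shift-suc (Cap τ * Cap τ + (Y - 1#) * (Cap τ - 1#)) n))))

  Occ-quadratic : ∀ τ → (1# + X * Y - X) * Occ τ ≈ 1# + X * (X + Y - X * Y) * (Occ τ * Occ τ)
  Occ-quadratic τ = eliminate X Y (Cap τ) (Occ τ) (Cap-equation τ) (Occ-equation τ)

  module Solution (F : Pattern → ℕ → K.Carrier) (F≈Occ : ∀ τ → F τ ≈ Occ τ) where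

    F-quadratic : ∀ τ → (1# + X * Y - X) * F τ ≈ 1# + X * (X + Y - X * Y) * (F τ * F τ)
    F-quadratic τ = begin
      (1# + X * Y - X) * F τ                          ≈⟨ *-congˡ {x = 1# + X * Y - X} (F≈Occ τ) ⟩
      (1# + X * Y - X) * Occ τ                        ≈⟨ Occ-quadratic τ ⟩
      1# + X * (X + Y - X * Y) * (Occ τ * Occ τ)
        ≈⟨ +-congˡ {x = 1#} (*-congˡ {x = X * (X + Y - X * Y)} (*-cong {x = F τ} {u = F τ} (F≈Occ τ) (F≈Occ τ))) ⟨
      1# + X * (X + Y - X * Y) * (F τ * F τ)          ∎
      where open SetoidReasoning setoid

    F-independent : ∀ σ τ → F σ ≈ F τ
    F-independent σ τ = x∙y⁻¹≈ε⇒x≈y (F σ) (F τ) (shift-fixpoint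
      (1# - Y + (X + Y - X * Y) * (F σ + F τ))
      (difference X Y (F σ) (F τ) (F-quadratic σ) (F-quadratic τ)))

    root : Pattern → ℕ → K.Carrier
    root τ = 1# + X * Y - X - 2 · X * (X + Y - X * Y) * F τ

    root₀≈1 : ∀ τ → root τ 0 ≈ᴷ 1ᴷ
    root₀≈1 τ = K.trans (root-expansion X Y (F τ) 0) (K.trans
      (K.+-congˡ (shift-zero (Y - 1# - 2 · 1# * (X + Y - X * Y) * F τ))) (K.+-identityʳ 1ᴷ))

    root²≈discriminant : ∀ τ → root τ ^ 2 ≈ 1# - 2 · X - 3 · X ^ 2 - X * Y * (2 · 1# - 2 · X - X * Y)
    root²≈discriminant τ = discriminant X Y (F τ) (F-quadratic τ)

    F-quotient : ∀ τ → 2 · X * (X + Y - X * Y) * F τ ≈ 1# + X * Y - X - root τ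
    F-quotient τ = quotient (1# + X * Y - X) (2 · X * (X + Y - X * Y)) (F τ)

-- Specialisation to polynomials in y and comparison with the counts.

module ℤ[y] = CommutativeRing ℤ[y]-commutativeRing
open GeneratingFunction ℤ[y]-commutativeRing Defs.y
open Exp ℤ[y].semiring using () renaming (_^_ to _^ᴷ_)
open Polynomial using (coeff)

y-isVariable : ℤ⟦y⟧.IsVariable (coeff Defs.y)
y-isVariable = record { v₀≈0 = ≡.refl ; v₁≈1 = ≡.refl ; vₙ≈0 = λ _ → ≡.refl }

module y-Shift = ℤ⟦y⟧.Shift (coeff Defs.y) y-isVariable

-- Multiplication by y shifts coefficients, by the same shift lemmas that serve for X, applied one
-- level down.
coeff-^ : ∀ k r → coeff (Defs.y ^ᴷ k) r ≡ ℤ.+ indicator (does (k ℕ.≟ r))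
coeff-^ zero    zero    = ≡.refl
coeff-^ zero    (suc r) = ≡.refl
coeff-^ (suc k) zero    = y-Shift.shift-zero (coeff (Defs.y ^ᴷ k))
coeff-^ (suc k) (suc r) = ≡.trans (y-Shift.shift-suc (coeff (Defs.y ^ᴷ k)) r) (coeff-^ k r)

-- A word `w` contributes 1 to the coefficient of y^r exactly when `s w` is r, so taking
-- coefficients turns the weighted sum into a count.
coeff-Σ : ∀ (s : List ℕ → ℕ) ws r →
          coeff (Σ[ (λ w → Defs.y ^ᴷ s w) ] ws) r ≡ ℤ.+ length (filter (λ w → s w ℕ.≟ r) ws)
coeff-Σ s []       r = ≡.refl
coeff-Σ s (w ∷ ws) r = ≡.trans (≡.cong₂ ℤ._+_ (coeff-^ (s w) r) (coeff-Σ s ws r))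
  (≡.cong ℤ.+_ (≡.sym (length-filter-∷ (λ w → s w ℕ.≟ r) w ws)))

F≈Occ : ∀ τ → Defs.F τ Defs.≈ Occ τ
F≈Occ τ n r = ≡.trans (≡.cong ℤ.+_ (f≡count τ r n)) (≡.sym (coeff-Σ (occ τ) (avoiders n) r))

X-isVariable : ℤ[y]⟦x⟧.IsVariable Defs.X
X-isVariable = record { v₀≈0 = λ _ → ≡.refl ; v₁≈1 = λ _ → ≡.refl ; vₙ≈0 = λ _ _ → ≡.refl }

Y-isConstant : ℤ[y]⟦x⟧.IsConstant Defs.y Defs.Y
Y-isConstant = record { a₀≈k = λ _ → ≡.refl ; aₙ≈0 = λ _ _ → ≡.refl }

open Equations ℤ[y]-commutativeRing Defs.y Defs.X X-isVariable Defs.Y Y-isConstant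
open Solution Defs.F F≈Occ

denominator≉0 : let open Defs in 2 · X * (X + Y - X * Y) ≉ 0#
-- The coefficient of x y in 2x² + 2xy - 2x²y is 2, and it is found by evaluation.
denominator≉0 D≈0 with () ← D≈0 1 1

open Defs

theorem3p1 : F p123 ≈ F p321 ×
    (∃[ S ]
    S IsSqrtOf (1# - 2 · X - 3 · X ^ 2 - X * Y * (2 · 1# - 2 · X - X * Y)) ×
    F p321 IsQuotient (1# + X * Y - X - S) / (2 · X * (X + Y - X * Y)))
theorem3p1 =
  F-independent p123 p321 ,
  root p321 , (root₀≈1 p321 , root²≈discriminant p321) ,
  denominator≉0 , F-quotient p321
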